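{- Let $n,k$ be integers with $0<k<n/2$ and suppose the generalized Petersen graph $G(n,k)$ is not bipartite. Let $d:=\gcd(n,k)$ and let $a$ be the unique integer with $0<a<n/d$ such that $ak\equiv d \pmod n$. Then the following are equivalent: (a) $G(n,k)$ is a core; (b) some cycle of minimum odd length in $G(n,k)$ contains a spoke; (c) at least one of the following holds: (c.1) $n/d$ is even; (c.2) $a+d$ is even and $a\ge d+2$; (c.3) $a+d$ is odd and $a+d+2\le n/d$.
   Context: For integers $0<k<n/2$, the generalized Petersen graph $G(n,k)$ has vertex set $\{u_0,\dots,u_{n-1}\}\cup\{v_0,\dots,v_{n-1}\}$ (outer vertices $u_i$, inner vertices $v_i$) and edges $u_iu_{i+1}$ (outer rim), $v_iv_{i+k}$ (inner rims) and $u_iv_i$ (spokes), all indices modulo $n$. A graph is a core if every endomorphism (adjacency-preserving self-map of the vertex set) is an automorphism. -}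

module Defs where

open import Data.Nat using (ℕ; zero; suc; _+_; _*_; _%_; _≤_; NonZero)
open import Data.Nat.GCD using (gcd; gcd[m,n]∣m)
open import Data.Nat.Divisibility using (_∣_; quotient)
open import Data.Fin using (Fin; toℕ)
import Data.Fin as F
open import Data.Product using (Σ; _×_; _,_; proj₁)
open import Data.Sum using (_⊎_)
open import Data.Bool using (Bool)
open import Relation.Binary.PropositionalEquality using (_≡_; _≢_)
open import Relation.Nullary using (¬_)
open import Function.Definitions using (Bijective)

IsEndo : {V : Set} → (V → V → Set) → (V → V) → Set
IsEndo E f = ∀ {x y} → E x y → E (f x) (f y)

IsAuto : {V : Set} → (V → V → Set) → (V → V) → Set
IsAuto E f = Bijective _≡_ _≡_ f × IsEndo E f × (∀ {x y} → E (f x) (f y) → E x y)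

IsCore : {V : Set} → (V → V → Set) → Set
IsCore {V} E = (f : V → V) → IsEndo E f → IsAuto E f

IsBipartite : {V : Set} → (V → V → Set) → Set
IsBipartite {V} E = Σ (V → Bool) λ c → ∀ {x y} → E x y → c x ≢ c y

-- cyclic successor on Fin L : i ↦ i + 1 mod L
next : ∀ {L} → Fin L → Fin L
next {suc zero} F.zero = F.zero
next {suc (suc m)} F.zero = F.suc F.zero
next {suc (suc m)} (F.suc i) with next {suc m} i
... | F.zero = F.zero
... | F.suc j = F.suc (F.suc j)

record Cycle {V : Set} (E : V → V → Set) (L : ℕ) : Set where
  field
    len≥3  : 3 ≤ L
    vtx    : Fin L → V
    inj    : ∀ i j → vtx i ≡ vtx j → i ≡ j
    closed : ∀ i → E (vtx i) (vtx (next i))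
open Cycle public

Odd : ℕ → Set
Odd m = ¬ (2 ∣ m)

Even : ℕ → Set
Even m = 2 ∣ m

data Side : Set where
  outer inner : Side

GPVertex : ℕ → Set
GPVertex n = Side × Fin n

StepMod : (n : ℕ) .{{_ : NonZero n}} → ℕ → Fin n → Fin n → Set
StepMod n c i j = (toℕ i + c) % n ≡ toℕ j

GPAdj : (n k : ℕ) .{{_ : NonZero n}} → GPVertex n → GPVertex n → Set
GPAdj n k (outer , i) (outer , j) = StepMod n 1 i j ⊎ StepMod n 1 j i
GPAdj n k (inner , i) (inner , j) = StepMod n k i j ⊎ StepMod n k j i
GPAdj n k (outer , i) (inner , j) = i ≡ j
GPAdj n k (inner , i) (outer , j) = i ≡ j

IsSpoke : {n : ℕ} → GPVertex n → GPVertex n → Set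
IsSpoke x y = proj₁ x ≢ proj₁ y

SomeMinOddCycleHasSpoke : (n k : ℕ) .{{_ : NonZero n}} → Set
SomeMinOddCycleHasSpoke n k =
  Σ ℕ λ L → Σ (Cycle (GPAdj n k) L) λ C →
    Odd L
    × (∀ L′ → Cycle (GPAdj n k) L′ → Odd L′ → L ≤ L′)
    × Σ (Fin L) λ i → IsSpoke (vtx C i) (vtx C (next i))

n/d : ℕ → ℕ → ℕ
n/d n k = quotient (gcd[m,n]∣m n k)

{-# OPTIONS --safe #-}
-- Write m = n / d. Two integers p, q with n ∣ p + q k give a closed walk of length |p| + |q| + 2
-- through two spokes: p outer steps, a spoke, q inner steps, a spoke. Conversely, counting the net
-- numbers of outer and inner steps shows that a closed walk using a spoke is at least as long as such
-- a walk of the same parity. Hence (b) says that some such walk, with |p| + |q| = N odd, is a shortest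
-- odd closed walk.
--
-- (b) ⇒ (a): call a vertex rigid if any two of its neighbours are joined by a walk of length N. No
-- closed walk has length N, so an endomorphism f is bijective on the star of a rigid vertex x, and f x
-- is again rigid. If |p| ≥ 2 all outer vertices are rigid; otherwise |p| = 1, the inner rim is a single
-- cycle and all inner vertices are rigid. Either f preserves this side, or by rotation all vertices are
-- rigid. In the first case f hits all of this side, and then all spokes; in the second its image is closed
-- under adjacency. So f is onto, hence an automorphism.
--
-- (b) ⇔ (c) and (a) ⇒ (c): if m is odd and (c) fails, then a is congruent modulo m to some b with
-- |b| ≤ d and b ≡ d mod 2. On the one hand q ≡ - b p / d mod m then forces |p| + |q| ≥ m, while the
-- inner rims are closed walks of length m. On the other hand some ±1-walk rises by b in d steps, and
-- it yields a homomorphism onto an inner rim. If (c) holds, p = d with q = - a or q = m - a, or p = k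
-- with q = -1, is short enough.
module Submission where

open import Defs
open import Data.Bool using (Bool; true; false; not)
open import Data.Bool.Properties using (not-¬; not-injective)
open import Data.Fin using (Fin; toℕ; fromℕ<)
import Data.Fin as F
import Data.Fin.Properties as F
open import Data.Integer as ℤ using (ℤ; +_; -[1+_]; ∣_∣; 0ℤ; 1ℤ; -1ℤ)
import Data.Integer.DivMod as ℤ
import Data.Integer.Properties as ℤ
open import Data.Integer.Tactic.RingSolver using (solve-∀)
open import Data.Nat
open import Data.Nat.DivMod
open import Data.Nat.Divisibility
open import Data.Nat.GCD using (gcd; gcd[m,n]∣m; gcd[m,n]∣n; gcd[m,n]≢0)
open import Data.Nat.Induction using (<-rec)
open import Data.Nat.Properties
open import Data.Nat.Tactic.RingSolver using () renaming (solve-∀ to ℕ-solve-∀)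
open import Data.Product using (Σ; ∃; ∃₂; _×_; _,_; proj₁; proj₂; map₂)
open import Data.Sum using (_⊎_; inj₁; inj₂; [_,_]′)
open import Function using (_∘_)
open import Function.Bundles using (_⇔_; mk⇔)
open import Function.Definitions using (Injective)
open import Relation.Binary.Definitions using (DecidableEquality; tri<; tri≈; tri>)
open import Relation.Binary.PropositionalEquality
open import Relation.Nullary
open import Relation.Nullary.Decidable as Dec using (decidable-stable)

-- Parity

even⊎odd : ∀ m → Even m ⊎ Even (suc m)
even⊎odd zero = inj₁ (divides 0 refl)
even⊎odd (suc m) with even⊎odd m
... | inj₁ (divides q eq) = inj₂ (divides (suc q) (cong (suc ∘ suc) eq))
... | inj₂ e = inj₁ e

even-suc⇒odd : ∀ {m} → Even (suc m) → Odd m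
even-suc⇒odd {m} 2∣1+m 2∣m with ∣m+n∣m⇒∣n (subst (2 ∣_) (+-comm 1 m) 2∣1+m) 2∣m
... | divides zero ()
... | divides (suc _) ()

odd⇒even-suc : ∀ {m} → Odd m → Even (suc m)
odd⇒even-suc {m} odd with even⊎odd m
... | inj₁ e = contradiction e odd
... | inj₂ e = e

odd+odd : ∀ {a b} → Odd a → Odd b → Even (a + b)
odd+odd {a} {b} oa ob = ∣m+n∣m⇒∣n {2} {2} {a + b}
  (subst (2 ∣_) (cong suc (+-suc a b)) (∣m∣n⇒∣m+n (odd⇒even-suc oa) (odd⇒even-suc ob))) ∣-refl

odd-summand : ∀ a b → Odd (a + b) → Odd a ⊎ Odd b
odd-summand a b odd with 2 ∣? a
... | no ¬e = inj₁ ¬e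
... | yes e = inj₂ λ e′ → odd (∣m∣n⇒∣m+n e e′)

-- Self-maps of finite types

iterate : ∀ {V : Set} → (V → V) → ℕ → V → V
iterate f zero x = x
iterate f (suc t) x = f (iterate f t x)

iterate-shift : ∀ {V : Set} (f : V → V) t x → iterate f t (f x) ≡ f (iterate f t x)
iterate-shift f zero x = refl
iterate-shift f (suc t) x = cong f (iterate-shift f t x)

module _ {V : Set} {M : ℕ} (code : V → Fin M) (code-injective : Injective _≡_ _≡_ code) where

  private
    cancel : ∀ {f : V → V} → Injective _≡_ _≡_ f → ∀ {y} s t → s < t →
      iterate f s y ≡ iterate f t y → ∃ λ r → iterate f (suc r) y ≡ y
    cancel inj zero (suc t) _ eq = t , sym eq
    cancel inj (suc s) (suc t) (s≤s s<t) eq = cancel inj s t s<t (inj eq)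

  -- Among the first M + 1 iterates of y two coincide by the pigeonhole principle, and injectivity
  -- strips off their common part.
  periodic : ∀ {f : V → V} → Injective _≡_ _≡_ f → ∀ y → ∃ λ r → f (iterate f r y) ≡ y
  periodic {f} inj y with F.pigeonhole (n<1+n M) (λ t → code (iterate f (toℕ t) y))
  ... | s , t , s<t , eq = cancel inj (toℕ s) (toℕ t) s<t (code-injective eq)

  injective⇒surjective : ∀ {f : V → V} → Injective _≡_ _≡_ f → ∀ y → ∃ λ x → f x ≡ y
  injective⇒surjective {f} inj y with periodic inj y
  ... | r , eq = iterate f r y , eq

  -- A section of `f` is injective, hence onto by finiteness. So x and y are both values of the
  -- section, and there `f` can be undone.
  surjective⇒injective : ∀ {f : V → V} → (∀ y → ∃ λ x → f x ≡ y) → Injective _≡_ _≡_ f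
  surjective⇒injective {f} surj {x} {y} eq with injective⇒surjective section-injective x
                                             | injective⇒surjective section-injective y
    where
    section-injective : Injective _≡_ _≡_ (proj₁ ∘ surj)
    section-injective {x} {y} e = trans (sym (proj₂ (surj x))) (trans (cong f e) (proj₂ (surj y)))
  ... | x′ , refl | y′ , refl =
    cong (proj₁ ∘ surj) (trans (sym (proj₂ (surj x′))) (trans eq (proj₂ (surj y′))))

-- Some power of f × f fixes (x , y), so f reflects edges.
surjective-endo⇒auto : ∀ {V : Set} {M} {E : V → V → Set} (code : V → Fin M) →
  Injective _≡_ _≡_ code → ∀ {f} → IsEndo E f → (∀ y → ∃ λ x → f x ≡ y) → IsAuto E f
surjective-endo⇒auto {V} {M} {E} code code-injective {f} endo surj =
  (injective , λ y → proj₁ (surj y) , λ { refl → proj₂ (surj y) }) , endo , reflects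
  where
  injective : Injective _≡_ _≡_ f
  injective = surjective⇒injective code code-injective surj

  code² : V × V → Fin (M * M)
  code² (x , y) = F.combine (code x) (code y)

  code²-injective : Injective _≡_ _≡_ code²
  code²-injective {x , y} {x′ , y′} eq with F.combine-injective (code x) (code y) (code x′) (code y′) eq
  ... | p , q = cong₂ _,_ (code-injective p) (code-injective q)

  f² : V × V → V × V
  f² (x , y) = f x , f y

  f²-injective : Injective _≡_ _≡_ f²
  f²-injective eq = cong₂ _,_ (injective (cong proj₁ eq)) (injective (cong proj₂ eq))

  E² : V × V → Set
  E² (x , y) = E x y

  iterate-E² : ∀ t {xy} → E² xy → E² (iterate f² t xy)
  iterate-E² zero e = e
  iterate-E² (suc t) e = endo (iterate-E² t e)

  reflects : ∀ {x y} → E (f x) (f y) → E x y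
  reflects {x} {y} e with periodic code² code²-injective f²-injective (x , y)
  ... | r , eq = subst E² (trans (iterate-shift f² r (x , y)) eq) (iterate-E² r e)

-- Walks

module _ {V : Set} (E : V → V → Set) where

  Walk : ℕ → V → V → Set
  Walk zero x y = x ≡ y
  Walk (suc ℓ) x y = ∃ λ z → E x z × Walk ℓ z y

  -- Closed walks stand in for cycles because endomorphisms carry walks to walks, but not cycles to
  -- cycles. At the minimal odd length the two notions agree.
  NoShorterOddWalk : ℕ → Set
  NoShorterOddWalk L = ∀ ℓ {x} → Odd ℓ → Walk ℓ x x → L ≤ ℓ

module _ {V : Set} {E : V → V → Set} where

  infixr 5 _++_
  _++_ : ∀ {a b x y z} → Walk E a x y → Walk E b y z → Walk E (a + b) x z
  _++_ {zero} refl w = w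
  _++_ {suc a} (z , e , v) w = z , e , v ++ w

  reverse : (∀ {x y} → E x y → E y x) → ∀ {a x y} → Walk E a x y → Walk E a y x
  reverse E-sym {zero} refl = refl
  reverse E-sym {suc a} {x} {y} (z , e , w) =
    subst (λ ℓ → Walk E ℓ y x) (+-comm a 1) (reverse E-sym w ++ (x , E-sym e , refl))

  map-walk : ∀ {f} → IsEndo E f → ∀ {a x y} → Walk E a x y → Walk E a (f x) (f y)
  map-walk endo {zero} refl = refl
  map-walk {f} endo {suc a} (z , e , w) = f z , endo e , map-walk endo w

  -- Total in the index: past its length the walk stays at its last vertex.
  at : ∀ {ℓ x y} → Walk E ℓ x y → ℕ → V
  at {zero} {x} _ _ = x
  at {suc ℓ} {x} _ zero = x
  at {suc ℓ} (_ , _ , w) (suc t) = at w t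

  at-start : ∀ {ℓ x y} (w : Walk E ℓ x y) → at w 0 ≡ x
  at-start {zero} w = refl
  at-start {suc ℓ} w = refl

  at-end : ∀ {ℓ x y} (w : Walk E ℓ x y) → at w ℓ ≡ y
  at-end {zero} refl = refl
  at-end {suc ℓ} (_ , _ , w) = at-end w

  at-step : ∀ {ℓ x y} (w : Walk E ℓ x y) t → t < ℓ → E (at w t) (at w (suc t))
  at-step {suc ℓ} {x} (z , e , w) zero _ = subst (E x) (sym (at-start w)) e
  at-step {suc ℓ} (z , e , w) (suc t) (s≤s t<ℓ) = at-step w t t<ℓ

  split : ∀ {ℓ x y} (w : Walk E ℓ x y) t → t < ℓ →
    ∃ λ b → t + suc b ≡ ℓ × Walk E t x (at w t) × Walk E (suc b) (at w t) y
  split {suc ℓ} w zero _ = ℓ , refl , refl , w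
  split {suc ℓ} (z , e , w) (suc t) (s≤s t<ℓ) with split w t t<ℓ
  ... | b , eq , w₁ , w₂ = b , cong suc eq , (z , e , w₁) , w₂

  -- Cutting at two visits to the same vertex separates a closed walk from the rest. Both lengths
  -- are successors, so each piece is strictly shorter than the whole.
  excise : ∀ {ℓ x y} (w : Walk E ℓ x y) i j → i < j → j < ℓ → at w i ≡ at w j →
    ∃₂ λ a b → suc a + suc b ≡ ℓ × Walk E (suc a) (at w i) (at w i) × Walk E (suc b) x y
  excise {suc ℓ} {x} {y} w zero (suc j) _ j<ℓ eq with split w (suc j) j<ℓ
  ... | b , len , w₁ , w₂ =
    j , b , len , subst (Walk E (suc j) x) (sym eq) w₁ , subst (λ v → Walk E (suc b) v y) (sym eq) w₂
  excise {suc ℓ} (z , e , w) (suc i) (suc j) (s≤s i<j) (s≤s j<ℓ) eq with excise w i j i<j j<ℓ eq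
  ... | a , b , len , w₁ , w₂ = a , suc b , trans (+-suc (suc a) (suc b)) (cong suc len) , w₁ , (z , e , w₂)

  -- Both pieces are closed because `w` is, and their lengths have an odd sum.
  excise-odd : ∀ {ℓ x} → Odd ℓ → (w : Walk E ℓ x x) → ∀ i j → i < j → j < ℓ → at w i ≡ at w j →
    ∃₂ λ ℓ′ z → ℓ′ < ℓ × Odd ℓ′ × Walk E ℓ′ z z
  excise-odd {ℓ} {x} odd w i j i<j j<ℓ eq with excise w i j i<j j<ℓ eq
  ... | a , b , refl , w₁ , w₂ with odd-summand (suc a) (suc b) odd
  ... | inj₁ oa = suc a , _ , m<m+n (suc a) z<s , oa , w₁
  ... | inj₂ ob = suc b , x , m<n+m (suc b) z<s , ob , w₂

-- Cycles and closed walks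

next-spec : ∀ {L} (i : Fin L) →
  (suc (toℕ i) ≡ L × toℕ (next i) ≡ 0) ⊎ (toℕ (next i) ≡ suc (toℕ i))
next-spec {suc zero} F.zero = inj₁ (refl , refl)
next-spec {suc (suc m)} F.zero = inj₂ refl
next-spec {suc (suc m)} (F.suc i) with next {suc m} i | next-spec {suc m} i
... | F.zero | inj₁ (eq , _) = inj₁ (cong suc eq , refl)
... | F.zero | inj₂ ()
... | F.suc j | inj₁ (_ , ())
... | F.suc j | inj₂ eq = inj₂ (cong suc eq)

module _ {V : Set} {E : V → V → Set} (loopless : ∀ {x} → ¬ E x x) where

  odd-closed⇒≥3 : ∀ {ℓ x} → Odd ℓ → Walk E ℓ x x → 3 ≤ ℓ
  odd-closed⇒≥3 {zero} odd w = contradiction (2 ∣0) odd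
  odd-closed⇒≥3 {suc zero} odd (_ , e , refl) = contradiction e loopless
  odd-closed⇒≥3 {suc (suc zero)} odd w = contradiction ∣-refl odd
  odd-closed⇒≥3 {suc (suc (suc ℓ))} odd w = s≤s (s≤s (s≤s z≤n))

  closedWalk⇒cycle : ∀ {ℓ x} → Odd ℓ → (w : Walk E ℓ x x) →
    (∀ i j → i < j → j < ℓ → at w i ≢ at w j) →
    Σ (Cycle E ℓ) λ C → ∀ i → vtx C i ≡ at w (toℕ i)
  closedWalk⇒cycle {ℓ} {x} odd w distinct = record
    { len≥3 = odd-closed⇒≥3 odd w
    ; vtx = λ i → at w (toℕ i)
    ; inj = inj-at
    ; closed = closed-at
    } , λ _ → refl
    where
    inj-at : ∀ (i j : Fin ℓ) → at w (toℕ i) ≡ at w (toℕ j) → i ≡ j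
    inj-at i j eq with <-cmp (toℕ i) (toℕ j)
    ... | tri< i<j _ _ = contradiction eq (distinct _ _ i<j (F.toℕ<n j))
    ... | tri≈ _ i≡j _ = F.toℕ-injective i≡j
    ... | tri> _ _ j<i = contradiction (sym eq) (distinct _ _ j<i (F.toℕ<n i))

    closed-at : ∀ (i : Fin ℓ) → E (at w (toℕ i)) (at w (toℕ (next i)))
    closed-at i with next-spec i | at-step w (toℕ i) (F.toℕ<n i)
    -- The last edge leads to the end of the walk, which is its start, the vertex to which `next`
    -- wraps around.
    ... | inj₁ (last , wrap) | e =
      subst (E _) (trans (cong (at w) last) (trans (at-end w)
        (sym (trans (cong (at w) wrap) (at-start w))))) e
    ... | inj₂ eq | e = subst (E _) (cong (at w) (sym eq)) e

  minimal⇒cycle : ∀ {ℓ x} → Odd ℓ → NoShorterOddWalk E ℓ → (w : Walk E ℓ x x) →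
    Σ (Cycle E ℓ) λ C → ∀ i → vtx C i ≡ at w (toℕ i)
  minimal⇒cycle odd min w = closedWalk⇒cycle odd w λ i j i<j j<ℓ eq →
    let (ℓ′ , _ , ℓ′<ℓ , odd′ , w′) = excise-odd odd w i j i<j j<ℓ eq in
    <⇒≱ ℓ′<ℓ (min ℓ′ odd′ w′)

  -- Prescribing the first edge places it at index zero of the cycle; in the application this edge
  -- is a spoke.
  minimal⇒cycle-from : ∀ {ℓ x y} → Odd (suc ℓ) → NoShorterOddWalk E (suc ℓ) → E x y → Walk E ℓ y x →
    Σ (Cycle E (suc ℓ)) λ C → vtx C F.zero ≡ x × vtx C (next F.zero) ≡ y
  minimal⇒cycle-from {ℓ} {x} {y} odd min e w = C , vtx-C F.zero , second (next-spec {suc ℓ} F.zero)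
    where
    w⁺ : Walk E (suc ℓ) x x
    w⁺ = y , e , w

    C = proj₁ (minimal⇒cycle odd min w⁺)
    vtx-C = proj₂ (minimal⇒cycle odd min w⁺)

    second : (1 ≡ suc ℓ × toℕ (next {suc ℓ} F.zero) ≡ 0) ⊎ toℕ (next {suc ℓ} F.zero) ≡ 1 → vtx C (next F.zero) ≡ y
    -- `next` fixes index zero only in length 1, and a cycle has length at least 3.
    second (inj₁ (1≡L , _)) = contradiction (subst (3 ≤_) (sym 1≡L) (len≥3 C)) λ { (s≤s ()) }
    second (inj₂ next≡1) = trans (vtx-C (next F.zero)) (trans (cong (at w⁺) next≡1) (at-start w))

  module _ (_≟_ : DecidableEquality V) where

    -- Strong induction on the length: a walk without repeated vertices is already a cycle, and a
    -- repetition yields a shorter odd closed walk.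
    contains-odd-cycle : ∀ {ℓ x} → Odd ℓ → Walk E ℓ x x → ∃ λ ℓ′ → ℓ′ ≤ ℓ × Odd ℓ′ × Cycle E ℓ′
    contains-odd-cycle {ℓ} = <-rec Contains search ℓ
      where
      Contains : ℕ → Set
      Contains ℓ = ∀ {x} → Odd ℓ → Walk E ℓ x x → ∃ λ ℓ′ → ℓ′ ≤ ℓ × Odd ℓ′ × Cycle E ℓ′

      search : ∀ ℓ → (∀ {m} → m < ℓ → Contains m) → Contains ℓ
      search ℓ rec odd w with F.any? (λ (i : Fin ℓ) → F.any? λ (j : Fin ℓ) →
        (toℕ i <? toℕ j) ×-dec (at w (toℕ i) ≟ at w (toℕ j)))
      ... | yes (i , j , i<j , eq) =
        let (m , _ , m<ℓ , odd′ , w′) = excise-odd odd w _ _ i<j (F.toℕ<n j) eq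
            (ℓ′ , ℓ′≤m , rest) = rec m<ℓ odd′ w′
        in ℓ′ , ≤-trans ℓ′≤m (<⇒≤ m<ℓ) , rest
      ... | no ¬repeat = ℓ , ≤-refl , odd , proj₁ (closedWalk⇒cycle odd w λ i j i<j j<ℓ eq →
        let i<ℓ = <-trans i<j j<ℓ in ¬repeat
          ( fromℕ< i<ℓ , fromℕ< j<ℓ
          , subst₂ _<_ (sym (F.toℕ-fromℕ< i<ℓ)) (sym (F.toℕ-fromℕ< j<ℓ)) i<j
          , subst₂ (λ s t → at w s ≡ at w t) (sym (F.toℕ-fromℕ< i<ℓ)) (sym (F.toℕ-fromℕ< j<ℓ)) eq))

module _ {L : ℕ} .{{_ : NonZero L}} where

  suc-% : ∀ t → suc (t % L) % L ≡ suc t % L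
  suc-% t = begin
    (1 + t % L) % L           ≡⟨ %-distribˡ-+ 1 (t % L) L ⟩
    (1 % L + t % L % L) % L   ≡⟨ cong (λ r → (1 % L + r) % L) (m%n%n≡m%n t L) ⟩
    (1 % L + t % L) % L       ≡⟨ %-distribˡ-+ 1 t L ⟨
    (1 + t) % L               ∎
    where open ≡-Reasoning

  toℕ-next : ∀ (i : Fin L) → toℕ (next i) ≡ suc (toℕ i) % L
  toℕ-next i with next-spec i
  ... | inj₁ (last , wrap) = trans wrap (sym (trans (cong (_% L) last) (n%n≡0 L)))
  ... | inj₂ eq = trans eq (sym (m<n⇒m%n≡m (subst (_< L) eq (F.toℕ<n (next i)))))

  toℕ-iterate-next : ∀ t (i : Fin L) → toℕ (iterate next t i) ≡ (t + toℕ i) % L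
  toℕ-iterate-next zero i = sym (m<n⇒m%n≡m (F.toℕ<n i))
  toℕ-iterate-next (suc t) i = begin
    toℕ (next (iterate next t i))      ≡⟨ toℕ-next (iterate next t i) ⟩
    suc (toℕ (iterate next t i)) % L   ≡⟨ cong (λ r → suc r % L) (toℕ-iterate-next t i) ⟩
    suc ((t + toℕ i) % L) % L          ≡⟨ suc-% (t + toℕ i) ⟩
    suc (t + toℕ i) % L                ∎
    where open ≡-Reasoning

  iterate-next-cyclic : ∀ (i : Fin L) → iterate next L i ≡ i
  iterate-next-cyclic i = F.toℕ-injective (begin
    toℕ (iterate next L i)   ≡⟨ toℕ-iterate-next L i ⟩
    (L + toℕ i) % L          ≡⟨ cong (_% L) (+-comm L (toℕ i)) ⟩
    (toℕ i + L) % L          ≡⟨ [m+n]%n≡m%n (toℕ i) L ⟩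
    toℕ i % L                ≡⟨ m<n⇒m%n≡m (F.toℕ<n i) ⟩
    toℕ i                    ∎)
    where open ≡-Reasoning

module _ {V : Set} {E : V → V → Set} where

  cycle-walk : ∀ {L} (C : Cycle E L) t i → Walk E t (vtx C i) (vtx C (iterate next t i))
  cycle-walk C zero i = refl
  cycle-walk C (suc t) i =
    vtx C (next i) , closed C i ,
    subst (λ j → Walk E t (vtx C (next i)) (vtx C j)) (iterate-shift next t i) (cycle-walk C t (next i))

  -- The rest of the cycle after one edge is removed, so that the cycle can be read as a closed walk
  -- beginning with any chosen edge.
  cycle-return : ∀ {L} (C : Cycle E (suc L)) i → Walk E L (vtx C (next i)) (vtx C i)
  cycle-return {L} C i =
    subst (λ j → Walk E L (vtx C (next i)) (vtx C j))
      (trans (iterate-shift next L i) (iterate-next-cyclic i)) (cycle-walk C L (next i))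

  minimal-cycle⇒minimal-walk : (∀ {x} → ¬ E x x) → DecidableEquality V →
    ∀ {L} → (∀ L′ → Cycle E L′ → Odd L′ → L ≤ L′) → NoShorterOddWalk E L
  minimal-cycle⇒minimal-walk loopless _≟_ min ℓ odd w =
    let (ℓ′ , ℓ′≤ℓ , odd′ , C) = contains-odd-cycle loopless _≟_ odd w
    in ≤-trans (min ℓ′ C odd′) ℓ′≤ℓ

-- Congruences of integers

module Congruence (n : ℕ) .{{_ : NonZero n}} where

  infix 4 _≋_
  -- An integer multiplier lets congruences be combined linearly by the ring solver, and the record
  -- lets both sides be inferred.
  record _≋_ (x y : ℤ) : Set where
    constructor _,_
    field
      multiplier : ℤ
      difference : x ℤ.- y ≡ multiplier ℤ.* + n

  ≋-reflexive : ∀ {x y} → x ≡ y → x ≋ y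
  ≋-reflexive {x} refl = 0ℤ , ℤ.+-inverseʳ x

  -- Congruences are derived by exhibiting the difference of the two sides as a
  -- linear combination of the differences of the given ones.
  ≋-linear₁ : ∀ c {x y x₁ y₁} → x₁ ≋ y₁ → x ℤ.- y ≡ c ℤ.* (x₁ ℤ.- y₁) → x ≋ y
  ≋-linear₁ c (t , eq) comb = c ℤ.* t , trans comb (trans (cong (c ℤ.*_) eq) (sym (ℤ.*-assoc c t (+ n))))

  ≋-linear₂ : ∀ c d {x y x₁ y₁ x₂ y₂} → x₁ ≋ y₁ → x₂ ≋ y₂ →
    x ℤ.- y ≡ c ℤ.* (x₁ ℤ.- y₁) ℤ.+ d ℤ.* (x₂ ℤ.- y₂) → x ≋ y
  ≋-linear₂ c d (t , eq₁) (u , eq₂) comb = c ℤ.* t ℤ.+ d ℤ.* u ,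
    trans comb (trans (cong₂ (λ a b → c ℤ.* a ℤ.+ d ℤ.* b) eq₁ eq₂) (factor c d t u (+ n)))
    where
    factor : ∀ c d t u n → c ℤ.* (t ℤ.* n) ℤ.+ d ℤ.* (u ℤ.* n) ≡ (c ℤ.* t ℤ.+ d ℤ.* u) ℤ.* n
    factor = solve-∀

  ≋-sym : ∀ {x y} → x ≋ y → y ≋ x
  ≋-sym {x} {y} x≋y = ≋-linear₁ -1ℤ x≋y (eq x y)
    where
    eq : ∀ x y → y ℤ.- x ≡ -1ℤ ℤ.* (x ℤ.- y)
    eq = solve-∀

  ≋-trans : ∀ {x y z} → x ≋ y → y ≋ z → x ≋ z
  ≋-trans {x} {y} {z} x≋y y≋z = ≋-linear₂ 1ℤ 1ℤ x≋y y≋z (eq x y z)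
    where
    eq : ∀ x y z → x ℤ.- z ≡ 1ℤ ℤ.* (x ℤ.- y) ℤ.+ 1ℤ ℤ.* (y ℤ.- z)
    eq = solve-∀

  ≋-+-congˡ : ∀ z {x y} → x ≋ y → z ℤ.+ x ≋ z ℤ.+ y
  ≋-+-congˡ z {x} {y} x≋y = ≋-linear₁ 1ℤ x≋y (eq z x y)
    where
    eq : ∀ z x y → (z ℤ.+ x) ℤ.- (z ℤ.+ y) ≡ 1ℤ ℤ.* (x ℤ.- y)
    eq = solve-∀

  ≋0⇒∣ : ∀ {x} → x ≋ 0ℤ → n ∣ ∣ x ∣
  ≋0⇒∣ {x} (t , eq) = divides ∣ t ∣
    (trans (cong ∣_∣ (trans (sym (ℤ.+-identityʳ x)) eq)) (ℤ.abs-* t (+ n)))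

  %-≋ : ∀ a → + (a % n) ≋ + a
  %-≋ a = ℤ.- + (a / n) , trans (cong (λ z → + (a % n) ℤ.- z) division) (eq (+ (a % n)) (+ (a / n)) (+ n))
    where
    division : + a ≡ + (a % n) ℤ.+ + (a / n) ℤ.* + n
    division = trans (cong +_ (m≡m%n+[m/n]*n a n)) (cong (λ z → + (a % n) ℤ.+ z) (ℤ.pos-* (a / n) n))

    eq : ∀ r q n → r ℤ.- (r ℤ.+ q ℤ.* n) ≡ ℤ.- q ℤ.* n
    eq = solve-∀

  ≋⇒%≡ : ∀ {a b} → + a ≋ + b → a % n ≡ b % n
  ≋⇒%≡ {a} {b} (+ t , eq) = trans (cong (_% n) a≡b+tn) ([m+kn]%n≡m%n b t n)
    where
    solved : ∀ a b → a ≡ b ℤ.+ (a ℤ.- b)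
    solved = solve-∀
    a≡b+tn : a ≡ b + t * n
    a≡b+tn = ℤ.+-injective (trans (solved (+ a) (+ b))
      (cong (λ z → + b ℤ.+ z) (trans eq (sym (ℤ.pos-* t n)))))
  -- For a negative multiplier a and b change places, so that the equation holds between natural
  -- numbers.
  ≋⇒%≡ {a} {b} (-[1+ t ] , eq) = sym (trans (cong (_% n) b≡a+tn) ([m+kn]%n≡m%n a (suc t) n))
    where
    solved : ∀ a b → b ≡ a ℤ.+ ℤ.- (a ℤ.- b)
    solved = solve-∀
    b≡a+tn : b ≡ a + suc t * n
    b≡a+tn = ℤ.+-injective (trans (solved (+ a) (+ b))
      (cong (λ z → + a ℤ.+ z) (trans (cong ℤ.-_ eq)
        (trans (ℤ.neg-distribˡ-* -[1+ t ] (+ n)) (sym (ℤ.pos-* (suc t) n))))))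

  abstract
    residue : ∀ z → ∃ λ (i : Fin n) → + toℕ i ≋ z
    residue z = fromℕ< (ℤ.n%ℕd<d z n) , ≋-sym (z ℤ./ℕ n ,
      trans (cong₂ ℤ._-_ (ℤ.a≡a%ℕn+[a/ℕn]*n z n) (cong +_ (F.toℕ-fromℕ< (ℤ.n%ℕd<d z n))))
            (eq (+ (z ℤ.%ℕ n)) (z ℤ./ℕ n) (+ n)))
      where
      eq : ∀ r q n → (r ℤ.+ q ℤ.* n) ℤ.- r ≡ q ℤ.* n
      eq = solve-∀

  residue-unique : ∀ {i j : Fin n} → + toℕ i ≋ + toℕ j → i ≡ j
  residue-unique {i} {j} i≋j = F.toℕ-injective
    (trans (sym (m<n⇒m%n≡m (F.toℕ<n i))) (trans (≋⇒%≡ i≋j) (m<n⇒m%n≡m (F.toℕ<n j))))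

  -- Moving along indices is a relation, not a function, so that composing and inverting moves just
  -- adds and negates displacements.
  record Shift (c : ℤ) (i j : Fin n) : Set where
    constructor shifted
    field
      congruence : + toℕ j ≋ + toℕ i ℤ.+ c
  open Shift

  shift : ∀ c i → ∃ (Shift c i)
  shift c i = map₂ shifted (residue (+ toℕ i ℤ.+ c))

  shift-unique : ∀ {c i j j′} → Shift c i j → Shift c i j′ → j ≡ j′
  shift-unique (shifted p) (shifted q) = residue-unique (≋-trans p (≋-sym q))

  shift-resp : ∀ {c d i j} → c ≋ d → Shift c i j → Shift d i j
  shift-resp {i = i} c≋d (shifted p) = shifted (≋-trans p (≋-+-congˡ (+ toℕ i) c≋d))

  shift-cast : ∀ {c d i j} → c ≡ d → Shift c i j → Shift d i j
  shift-cast refl p = p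

  shift-refl : ∀ {c i} → c ≋ 0ℤ → Shift c i i
  shift-refl {c} {i} c≋0 = shifted (≋-linear₁ -1ℤ c≋0 (eq (+ toℕ i) c))
    where
    eq : ∀ i c → i ℤ.- (i ℤ.+ c) ≡ -1ℤ ℤ.* (c ℤ.- 0ℤ)
    eq = solve-∀

  shift-loop : ∀ {c i} → Shift c i i → c ≋ 0ℤ
  shift-loop {c} {i} (shifted p) = ≋-linear₁ -1ℤ p (eq (+ toℕ i) c)
    where
    eq : ∀ i c → c ℤ.- 0ℤ ≡ -1ℤ ℤ.* (i ℤ.- (i ℤ.+ c))
    eq = solve-∀

  shift-trans : ∀ {c d i j l} → Shift c i j → Shift d j l → Shift (c ℤ.+ d) i l
  shift-trans {c} {d} {i} {j} {l} (shifted p) (shifted q) =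
    shifted (≋-linear₂ 1ℤ 1ℤ p q (eq c d (+ toℕ i) (+ toℕ j) (+ toℕ l)))
    where
    eq : ∀ c d i j l → l ℤ.- (i ℤ.+ (c ℤ.+ d)) ≡ 1ℤ ℤ.* (j ℤ.- (i ℤ.+ c)) ℤ.+ 1ℤ ℤ.* (l ℤ.- (j ℤ.+ d))
    eq = solve-∀

  shift-sym : ∀ {c i j} → Shift c i j → Shift (ℤ.- c) j i
  shift-sym {c} {i} {j} (shifted p) = shifted (≋-linear₁ -1ℤ p (eq c (+ toℕ i) (+ toℕ j)))
    where
    eq : ∀ c i j → i ℤ.- (j ℤ.+ ℤ.- c) ≡ -1ℤ ℤ.* (j ℤ.- (i ℤ.+ c))
    eq = solve-∀

  stepMod⇒shift : ∀ {c i j} → StepMod n c i j → Shift (+ c) i j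
  stepMod⇒shift {c} {i} stepEq = shifted (subst (λ r → + r ≋ + toℕ i ℤ.+ + c) stepEq (%-≋ (toℕ i + c)))

  shift⇒stepMod : ∀ {c i j} → Shift (+ c) i j → StepMod n c i j
  shift⇒stepMod {c} {i} {j} (shifted p) = trans (sym (≋⇒%≡ p)) (m<n⇒m%n≡m (F.toℕ<n j))

-- Walks in generalized Petersen graphs

IsUnit : ℤ → Set
IsUnit u = u ≡ 1ℤ ⊎ u ≡ -1ℤ

-- If p is negative, the new step cancels one of p, and c = 1 pays for the two lost edges. This
-- keeps the length and its parity readable from net counts.
∣1+_∣ : ∀ p → ∃ λ c → ∣ 1ℤ ℤ.+ p ∣ + 2 * c ≡ suc (∣ p ∣)
∣1+ + m ∣ = 0 , +-identityʳ (suc m)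
∣1+ -[1+ zero ] ∣ = 1 , refl
∣1+ -[1+ suc m ] ∣ = 1 , cong suc (+-comm m 2)

∣unit+_∣ : ∀ {u} p → IsUnit u → ∃ λ c → ∣ u ℤ.+ p ∣ + 2 * c ≡ suc (∣ p ∣)
∣unit+ p ∣ (inj₁ refl) = ∣1+ p ∣
∣unit+ p ∣ (inj₂ refl) with ∣1+ ℤ.- p ∣
... | c , eq = c , trans (cong (_+ 2 * c) (trans (sym (ℤ.∣-i∣≡∣i∣ (-1ℤ ℤ.+ p))) (cong ∣_∣ (neg p))))
                         (trans eq (cong suc (ℤ.∣-i∣≡∣i∣ p)))
  where
  neg : ∀ p → ℤ.- (-1ℤ ℤ.+ p) ≡ 1ℤ ℤ.+ ℤ.- p
  neg = solve-∀

∣unit∣ : ∀ {u} → IsUnit u → ∣ u ∣ ≡ 1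
∣unit∣ (inj₁ refl) = refl
∣unit∣ (inj₂ refl) = refl

zero⊎unit⊎large : ∀ p → p ≡ 0ℤ ⊎ IsUnit p ⊎ 2 ≤ ∣ p ∣
zero⊎unit⊎large (+ zero) = inj₁ refl
zero⊎unit⊎large (+ suc zero) = inj₂ (inj₁ (inj₁ refl))
zero⊎unit⊎large (+ suc (suc _)) = inj₂ (inj₂ (s≤s (s≤s z≤n)))
zero⊎unit⊎large -[1+ zero ] = inj₂ (inj₁ (inj₂ refl))
zero⊎unit⊎large -[1+ suc _ ] = inj₂ (inj₂ (s≤s (s≤s z≤n)))

flip : Side → Side
flip outer = inner
flip inner = outer

flip-flip : ∀ s → flip (flip s) ≡ s
flip-flip outer = refl
flip-flip inner = refl

flip≢ : ∀ s → flip s ≢ s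
flip≢ outer ()
flip≢ inner ()

same⊎flip : ∀ s t → t ≡ s ⊎ t ≡ flip s
same⊎flip outer outer = inj₁ refl
same⊎flip outer inner = inj₂ refl
same⊎flip inner outer = inj₂ refl
same⊎flip inner inner = inj₁ refl

module Petersen (n k : ℕ) .{{_ : NonZero n}} where
  open Congruence n public

  V : Set
  V = GPVertex n

  E : V → V → Set
  E = GPAdj n k

  -- One parameter for both kinds of rim edges lets later arguments treat the two sides at once.
  step : Side → ℤ
  step outer = 1ℤ
  step inner = + k

  E-sym : ∀ {x y} → E x y → E y x
  E-sym {outer , _} {outer , _} (inj₁ e) = inj₂ e
  E-sym {outer , _} {outer , _} (inj₂ e) = inj₁ e
  E-sym {outer , _} {inner , _} e = sym e
  E-sym {inner , _} {outer , _} e = sym e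
  E-sym {inner , _} {inner , _} (inj₁ e) = inj₂ e
  E-sym {inner , _} {inner , _} (inj₂ e) = inj₁ e

  spoke : ∀ s i → E (s , i) (flip s , i)
  spoke outer i = refl
  spoke inner i = refl

  shift⇒edge : ∀ s {i j} → Shift (step s) i j → E (s , i) (s , j)
  shift⇒edge outer p = inj₁ (shift⇒stepMod p)
  shift⇒edge inner p = inj₁ (shift⇒stepMod p)

  unit-shift⇒edge : ∀ s {u i j} → IsUnit u → Shift (u ℤ.* step s) i j → E (s , i) (s , j)
  unit-shift⇒edge s (inj₁ refl) p = shift⇒edge s (shift-cast (ℤ.*-identityˡ (step s)) p)
  unit-shift⇒edge s (inj₂ refl) p = E-sym (shift⇒edge s (shift-cast (eq (step s)) (shift-sym p)))
    where
    eq : ∀ c → ℤ.- (-1ℤ ℤ.* c) ≡ c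
    eq = solve-∀

  side-edge⁻ : ∀ s {i j} → E (s , i) (s , j) → ∃ λ u → IsUnit u × Shift (u ℤ.* step s) i j
  side-edge⁻ s e = units s e
    where
    fwd : ∀ s {i j} → Shift (step s) i j → ∃ λ u → IsUnit u × Shift (u ℤ.* step s) i j
    fwd s p = 1ℤ , inj₁ refl , shift-cast (sym (ℤ.*-identityˡ (step s))) p
    bwd : ∀ s {i j} → Shift (step s) j i → ∃ λ u → IsUnit u × Shift (u ℤ.* step s) i j
    bwd s p = -1ℤ , inj₂ refl , shift-cast (sym (ℤ.-1*i≡-i (step s))) (shift-sym p)
    units : ∀ s {i j} → E (s , i) (s , j) → ∃ λ u → IsUnit u × Shift (u ℤ.* step s) i j
    units outer (inj₁ e) = fwd outer (stepMod⇒shift e)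
    units outer (inj₂ e) = bwd outer (stepMod⇒shift e)
    units inner (inj₁ e) = fwd inner (stepMod⇒shift e)
    units inner (inj₂ e) = bwd inner (stepMod⇒shift e)

  spoke⁻ : ∀ s {i j} → E (s , i) (flip s , j) → i ≡ j
  spoke⁻ outer e = e
  spoke⁻ inner e = e

  edge⁻ : ∀ {s i t j} → E (s , i) (t , j) →
    (t ≡ flip s × i ≡ j) ⊎ (t ≡ s × ∃ λ u → IsUnit u × Shift (u ℤ.* step s) i j)
  edge⁻ {s} {_} {t} e with same⊎flip s t
  ... | inj₁ refl = inj₂ (refl , side-edge⁻ s e)
  ... | inj₂ refl = inj₁ (refl , spoke⁻ s e)

  unit-walk : ∀ s {u} → IsUnit u → ∀ m {i j} → Shift (+ m ℤ.* (u ℤ.* step s)) i j → Walk E m (s , i) (s , j)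
  unit-walk s isUnit zero p = cong (s ,_) (shift-unique (shift-refl (≋-reflexive refl)) p)
  unit-walk s {u} isUnit (suc m) {i} {j} p =
    let (l , q) = shift (u ℤ.* step s) i in
    (s , l) , unit-shift⇒edge s isUnit q ,
    unit-walk s isUnit m (shift-cast (eq (u ℤ.* step s) (+ m)) (shift-trans (shift-sym q) p))
    where
    eq : ∀ c m → ℤ.- c ℤ.+ (1ℤ ℤ.+ m) ℤ.* c ≡ m ℤ.* c
    eq = solve-∀

  side-walk : ∀ s p {i j} → Shift (p ℤ.* step s) i j → Walk E ∣ p ∣ (s , i) (s , j)
  side-walk s (+ m) p = unit-walk s (inj₁ refl) m (shift-cast (cong (+ m ℤ.*_) (sym (ℤ.*-identityˡ (step s)))) p)
  side-walk s -[1+ m ] p = unit-walk s (inj₂ refl) (suc m) (shift-cast (eq (+ suc m) (step s)) p)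
    where
    eq : ∀ m c → ℤ.- m ℤ.* c ≡ m ℤ.* (-1ℤ ℤ.* c)
    eq = solve-∀

  -- The net numbers p and q of edges traversed on the starting side and on the other one;
  -- c counts pairs of edges that cancel, and all spokes beyond the first two.
  data Trace (ℓ : ℕ) : V → V → Set where
    straight : ∀ {s i j} p c → ∣ p ∣ + 2 * c ≡ ℓ →
      Shift (p ℤ.* step s) i j → Trace ℓ (s , i) (s , j)
    crossing : ∀ {s t i j} p q c → t ≡ flip s → ∣ p ∣ + ∣ q ∣ + suc (2 * c) ≡ ℓ →
      Shift (p ℤ.* step s ℤ.+ q ℤ.* step (flip s)) i j → Trace ℓ (s , i) (t , j)
    returning : ∀ {s i j} p q c → ∣ p ∣ + ∣ q ∣ + (2 + 2 * c) ≡ ℓ →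
      Shift (p ℤ.* step s ℤ.+ q ℤ.* step (flip s)) i j → Trace ℓ (s , i) (s , j)

  -- Displacements add up regardless of the order of the edges, and spokes do not change the index.
  -- A spoke put in front exchanges p and q, as they are counted from the starting side.
  trace : ∀ {ℓ x y} → Walk E ℓ x y → Trace ℓ x y
  trace {zero} {s , i} refl = straight 0ℤ 0 refl (shift-refl (≋-reflexive refl))
  trace {suc ℓ} {s , i} (z , e , w) = prepend (edge⁻ e) (trace w)
    where
    after-spoke : ∀ {s i y} → Trace ℓ (flip s , i) y → Trace (suc ℓ) (s , i) y
    after-spoke {s} (straight p c len sh) = crossing 0ℤ p c refl
      (trans (+-suc ∣ p ∣ (2 * c)) (cong suc len))
      (shift-cast (eq p (step (flip s)) (step s)) sh)
      where
      eq : ∀ p c d → p ℤ.* c ≡ 0ℤ ℤ.* d ℤ.+ p ℤ.* c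
      eq = solve-∀
    after-spoke {s} (crossing p q c refl len sh) rewrite flip-flip s = returning q p c
      (trans (eq ∣ p ∣ ∣ q ∣ (2 * c)) (cong suc len))
      (shift-cast (ℤ.+-comm (p ℤ.* step (flip s)) (q ℤ.* step s)) sh)
      where
      eq : ∀ p q c → q + p + (2 + c) ≡ suc (p + q + suc c)
      eq = ℕ-solve-∀
    -- One spoke makes the crossing; the two that `returning` counted separately now form a pair,
    -- whence `suc c`.
    after-spoke {s} (returning p q c len sh) rewrite flip-flip s = crossing q p (suc c) refl
      (trans (eq ∣ p ∣ ∣ q ∣ c) (cong suc len))
      (shift-cast (ℤ.+-comm (p ℤ.* step (flip s)) (q ℤ.* step s)) sh)
      where
      eq : ∀ p q c → q + p + suc (2 * suc c) ≡ suc (p + q + (2 + 2 * c))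
      eq = ℕ-solve-∀

    after-side : ∀ {s i l y} → (∃ λ u → IsUnit u × Shift (u ℤ.* step s) i l) →
      Trace ℓ (s , l) y → Trace (suc ℓ) (s , i) y
    after-side {s} (u , isUnit , first) (straight p c len sh) =
      let (c′ , abs) = ∣unit+ p ∣ isUnit in
      straight (u ℤ.+ p) (c′ + c)
        (trans (eq ∣ u ℤ.+ p ∣ c′ c) (trans (cong (_+ 2 * c) abs) (cong suc len)))
        (shift-cast (sym (ℤ.*-distribʳ-+ (step s) u p)) (shift-trans first sh))
      where
      eq : ∀ a c d → a + 2 * (c + d) ≡ (a + 2 * c) + 2 * d
      eq = ℕ-solve-∀
    after-side {s} (u , isUnit , first) (crossing p q c t≡ len sh) =
      let (c′ , abs) = ∣unit+ p ∣ isUnit in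
      crossing (u ℤ.+ p) q (c′ + c) t≡
        (trans (eq ∣ u ℤ.+ p ∣ ∣ q ∣ c′ c) (trans (cong (λ a → a + ∣ q ∣ + suc (2 * c)) abs) (cong suc len)))
        (shift-cast (merge u p (step s) (q ℤ.* step (flip s))) (shift-trans first sh))
      where
      eq : ∀ a b c d → a + b + suc (2 * (c + d)) ≡ (a + 2 * c) + b + suc (2 * d)
      eq = ℕ-solve-∀
      merge : ∀ u p c d → u ℤ.* c ℤ.+ (p ℤ.* c ℤ.+ d) ≡ (u ℤ.+ p) ℤ.* c ℤ.+ d
      merge = solve-∀
    after-side {s} (u , isUnit , first) (returning p q c len sh) =
      let (c′ , abs) = ∣unit+ p ∣ isUnit in
      returning (u ℤ.+ p) q (c′ + c)
        (trans (eq ∣ u ℤ.+ p ∣ ∣ q ∣ c′ c) (trans (cong (λ a → a + ∣ q ∣ + (2 + 2 * c)) abs) (cong suc len)))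
        (shift-cast (merge u p (step s) (q ℤ.* step (flip s))) (shift-trans first sh))
      where
      eq : ∀ a b c d → a + b + (2 + 2 * (c + d)) ≡ (a + 2 * c) + b + (2 + 2 * d)
      eq = ℕ-solve-∀
      merge : ∀ u p c d → u ℤ.* c ℤ.+ (p ℤ.* c ℤ.+ d) ≡ (u ℤ.+ p) ℤ.* c ℤ.+ d
      merge = solve-∀

    prepend : ∀ {s i t l y} →
      (t ≡ flip s × i ≡ l) ⊎ (t ≡ s × ∃ λ u → IsUnit u × Shift (u ℤ.* step s) i l) →
      Trace ℓ (t , l) y → Trace (suc ℓ) (s , i) y
    prepend (inj₁ (refl , refl)) = after-spoke
    prepend (inj₂ (refl , first)) = after-side first

-- Rigid vertices and endomorphisms

module Endomorphisms (n k : ℕ) .{{_ : NonZero n}} where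
  open Petersen n k public

  -- The condition for p steps on side s, a spoke, q steps on the other side and a spoke to close
  -- up.
  Balanced : Side → ℤ → ℤ → Set
  Balanced s p q = p ℤ.* step s ℤ.+ q ℤ.* step (flip s) ≋ 0ℤ

  balanced-neg : ∀ s {p q} → Balanced s p q → Balanced s (ℤ.- p) (ℤ.- q)
  balanced-neg s {p} {q} b = ≋-linear₁ -1ℤ b (eq p q (step s) (step (flip s)))
    where
    eq : ∀ p q c d → (ℤ.- p ℤ.* c ℤ.+ ℤ.- q ℤ.* d) ℤ.- 0ℤ ≡ -1ℤ ℤ.* ((p ℤ.* c ℤ.+ q ℤ.* d) ℤ.- 0ℤ)
    eq = solve-∀

  balanced-flip : ∀ s {p q} → Balanced s p q → Balanced (flip s) q p
  balanced-flip s {p} {q} b rewrite flip-flip s =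
    subst (_≋ 0ℤ) (ℤ.+-comm (p ℤ.* step s) (q ℤ.* step (flip s))) b

  -- Replacing (p , q) by (- p , - q) if necessary, p points in the direction v.
  directed : ∀ s {v} m p {q} → IsUnit v → ∣ p ∣ ≡ m → Balanced s p q →
    ∃ λ q′ → ∣ q′ ∣ ≡ ∣ q ∣ × Balanced s (v ℤ.* + m) q′
  directed s m (+ .m) {q} (inj₁ refl) refl b =
    q , refl , subst (λ z → Balanced s z q) (sym (ℤ.*-identityˡ (+ m))) b
  directed s m (+ .m) {q} (inj₂ refl) refl b =
    ℤ.- q , ℤ.∣-i∣≡∣i∣ q , subst (λ z → Balanced s z (ℤ.- q)) (sym (ℤ.-1*i≡-i (+ m))) (balanced-neg s {+ m} {q} b)
  directed s m -[1+ m′ ] {q} (inj₁ refl) refl b =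
    ℤ.- q , ℤ.∣-i∣≡∣i∣ q , subst (λ z → Balanced s z (ℤ.- q)) (sym (ℤ.*-identityˡ (+ m))) (balanced-neg s { -[1+ m′ ]} {q} b)
  directed s m -[1+ m′ ] {q} (inj₂ refl) refl b =
    q , refl , subst (λ z → Balanced s z q) (sym (ℤ.-1*i≡-i (+ m))) b

  -- Numbering the neighbours turns maps between stars into self-maps of `Fin 3`.
  nb : V → Fin 3 → V
  nb (s , i) F.zero = flip s , i
  nb (s , i) (F.suc F.zero) = s , proj₁ (shift (1ℤ ℤ.* step s) i)
  nb (s , i) (F.suc (F.suc F.zero)) = s , proj₁ (shift (-1ℤ ℤ.* step s) i)

  nb-edge : ∀ x c → E x (nb x c)
  nb-edge (s , i) F.zero = spoke s i
  nb-edge (s , i) (F.suc F.zero) = unit-shift⇒edge s (inj₁ refl) (proj₂ (shift (1ℤ ℤ.* step s) i))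
  nb-edge (s , i) (F.suc (F.suc F.zero)) = unit-shift⇒edge s (inj₂ refl) (proj₂ (shift (-1ℤ ℤ.* step s) i))

  nb-cover : ∀ {x y} → E x y → ∃ λ c → nb x c ≡ y
  nb-cover {s , i} {t , j} e with edge⁻ e
  ... | inj₁ (refl , refl) = F.zero , refl
  ... | inj₂ (refl , _ , inj₁ refl , sh) =
    F.suc F.zero , cong (s ,_) (shift-unique (proj₂ (shift (1ℤ ℤ.* step s) i)) sh)
  ... | inj₂ (refl , _ , inj₂ refl , sh) =
    F.suc (F.suc F.zero) , cong (s ,_) (shift-unique (proj₂ (shift (-1ℤ ℤ.* step s) i)) sh)

  -- The closed two-spoke walk passes through i by a spoke and a rim edge. Deleting these two edges
  -- leaves m rim steps, a spoke and q steps on the other side.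
  bend-walk : ∀ s {v} m q {i j} → IsUnit v → Balanced s (v ℤ.* + suc m) q → Shift (v ℤ.* step s) i j →
    Walk E (suc m + ∣ q ∣) (s , j) (flip s , i)
  bend-walk s {v} m q {i} {j} isUnit b sh =
    let (l , sh′) = shift (+ m ℤ.* (v ℤ.* step s)) j in
    subst (λ ℓ → Walk E ℓ (s , j) (flip s , i)) (+-suc m ∣ q ∣)
      (unit-walk s isUnit m sh′ ++ ((flip s , l) , spoke s l ,
       side-walk (flip s) q (shift-resp (≋-linear₁ -1ℤ b (eq v (+ m) q (step s) (step (flip s))))
         (shift-trans (shift-sym sh′) (shift-sym sh)))))
    where
    eq : ∀ v m q c d → (ℤ.- (m ℤ.* (v ℤ.* c)) ℤ.+ ℤ.- (v ℤ.* c)) ℤ.- q ℤ.* d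
         ≡ -1ℤ ℤ.* (((v ℤ.* (1ℤ ℤ.+ m)) ℤ.* c ℤ.+ q ℤ.* d) ℤ.- 0ℤ)
    eq = solve-∀

  -- Now i lies inside the rim stretch of the closed walk, and its two rim edges are deleted; hence
  -- the stretch must have at least two edges.
  through-walk : ∀ s {v} m q {h i j} → IsUnit v → Balanced s (v ℤ.* + suc (suc m)) q →
    Shift (v ℤ.* step s) h i → Shift (v ℤ.* step s) i j →
    Walk E (suc (suc m) + ∣ q ∣) (s , j) (s , h)
  through-walk s {v} m q {h} {i} {j} isUnit b sh₁ sh₂ =
    let (l , sh′) = shift (+ m ℤ.* (v ℤ.* step s)) j in
    subst (λ ℓ → Walk E ℓ (s , j) (s , h)) (len m ∣ q ∣)
      (unit-walk s isUnit m sh′ ++ ((flip s , l) , spoke s l , (_++_ {a = ∣ q ∣} {b = 1}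
        (side-walk (flip s) q (shift-resp (≋-linear₁ -1ℤ b (eq v (+ m) q (step s) (step (flip s))))
          (shift-trans (shift-sym sh′) (shift-trans (shift-sym sh₂) (shift-sym sh₁)))))
        ((s , h) , E-sym (spoke s h) , refl))))
    where
    len : ∀ m q → m + (suc q + 1) ≡ suc (suc m) + q
    len = ℕ-solve-∀
    eq : ∀ v m q c d → (ℤ.- (m ℤ.* (v ℤ.* c)) ℤ.+ (ℤ.- (v ℤ.* c) ℤ.+ ℤ.- (v ℤ.* c))) ℤ.- q ℤ.* d
         ≡ -1ℤ ℤ.* (((v ℤ.* (+ 2 ℤ.+ m)) ℤ.* c ℤ.+ q ℤ.* d) ℤ.- 0ℤ)
    eq = solve-∀

  rotate : ℤ → V → V
  rotate c (s , i) = s , proj₁ (shift c i)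

  rotate-endo : ∀ c → IsEndo E (rotate c)
  rotate-endo c {s , i} {t , j} e with edge⁻ e
  ... | inj₁ (refl , refl) = spoke s _
  ... | inj₂ (refl , u , isUnit , sh) =
    unit-shift⇒edge s isUnit (shift-cast (eq c (u ℤ.* step s))
      (shift-trans (shift-sym (proj₂ (shift c i))) (shift-trans sh (proj₂ (shift c j)))))
    where
    eq : ∀ c d → ℤ.- c ℤ.+ (d ℤ.+ c) ≡ d
    eq = solve-∀

  rotate-to : ∀ s i j → ∃ λ c → rotate c (s , i) ≡ (s , j)
  rotate-to s i j = c , cong (s ,_) (shift-unique (proj₂ (shift c i)) (shifted (≋-reflexive (eq (+ toℕ i) (+ toℕ j)))))
    where
    c = + toℕ j ℤ.- + toℕ i
    eq : ∀ i j → j ≡ i ℤ.+ (j ℤ.- i)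
    eq = solve-∀

  -- The step is invertible modulo n, that is, the rim on this side is a single cycle.
  Generates : Side → Set
  Generates s = ∃ λ g → g ℤ.* step s ≋ 1ℤ

  outer-generates : Generates outer
  outer-generates = 1ℤ , ≋-reflexive refl

  side-connected : ∀ s → Generates s → (P : Fin n → Set) →
    (∀ {i j} → Shift (step s) i j → P i → P j) → ∀ i j → P i → P j
  side-connected s (g , gc≋1) P advance i j Pi =
    -- Since g inverts the step, r steps move the index by j - i. Taking r as a natural number uses
    -- forward steps only, for which alone `P` is assumed to be closed.
    let (r , r≋) = residue (d ℤ.* g) in
    repeat (toℕ r) (shifted (≋-linear₂ (ℤ.- step s) (ℤ.- d) r≋ gc≋1
      (eq (+ toℕ i) (+ toℕ j) (+ toℕ r) g (step s)))) Pi
    where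
    d = + toℕ j ℤ.- + toℕ i
    eq : ∀ i j r g c → j ℤ.- (i ℤ.+ r ℤ.* c)
         ≡ ℤ.- c ℤ.* (r ℤ.- (j ℤ.- i) ℤ.* g) ℤ.+ ℤ.- (j ℤ.- i) ℤ.* (g ℤ.* c ℤ.- 1ℤ)
    eq = solve-∀
    split-first : ∀ m c → ℤ.- c ℤ.+ (1ℤ ℤ.+ m) ℤ.* c ≡ m ℤ.* c
    split-first = solve-∀

    repeat : ∀ m {i j} → Shift (+ m ℤ.* step s) i j → P i → P j
    repeat zero sh Pi = subst P (shift-unique (shift-refl (≋-reflexive refl)) sh) Pi
    repeat (suc m) {i} {j} sh Pi =
      let (l , sh′) = shift (step s) i in
      repeat m (shift-cast (split-first (+ m) (step s)) (shift-trans (shift-sym sh′) sh)) (advance sh′ Pi)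

  connected : (P : V → Set) → (∀ {x y} → E x y → P x → P y) → ∀ {x} y → P x → P y
  connected P closed {s , i} (t , j) Px = from-outer t (side-connected outer outer-generates (λ l → P (outer , l))
      (λ sh → closed (shift⇒edge outer sh)) i j (to-outer s Px))
    where
    to-outer : ∀ s → P (s , i) → P (outer , i)
    to-outer outer Px = Px
    to-outer inner Px = closed (spoke inner i) Px
    from-outer : ∀ t → P (outer , j) → P (t , j)
    from-outer outer Py = Py
    from-outer inner Py = closed (spoke outer j) Py

  sideCode : Side → Fin 2
  sideCode outer = F.zero
  sideCode inner = F.suc F.zero

  sideCode-injective : ∀ {s t} → sideCode s ≡ sideCode t → s ≡ t
  sideCode-injective {outer} {outer} _ = refl
  sideCode-injective {inner} {inner} _ = refl

  code : V → Fin (2 * n)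
  code (s , i) = F.combine (sideCode s) i

  code-injective : Injective _≡_ _≡_ code
  code-injective {s , i} {t , j} eq =
    let (p , q) = F.combine-injective (sideCode s) i (sideCode t) j eq
    in cong₂ _,_ (sideCode-injective p) q

  -- A vertex is rigid if any two of its neighbours are joined by a walk of length N. As no closed
  -- walk has length N, an endomorphism is injective, hence bijective, on the star of a rigid vertex.
  module Rigidity (N : ℕ) (no-closed-N-walk : ∀ {x} → ¬ Walk E N x x) where

    Rigid : V → Set
    Rigid x = ∀ c d → c ≢ d → Walk E N (nb x c) (nb x d)

    -- Two neighbours of a vertex are either a rim neighbour and the mate, joined by `bend`, or the
    -- two rim neighbours, joined by `through`; the latter requires |p| ≥ 2.
    rigid-side : ∀ s p q → Balanced s p q → ∣ p ∣ + ∣ q ∣ ≡ N → 2 ≤ ∣ p ∣ → ∀ i → Rigid (s , i)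
    rigid-side s p q b len 2≤p i = rigid
      where
      m = ∣ p ∣ ∸ 2
      ∣p∣≡2+m : ∣ p ∣ ≡ 2 + m
      ∣p∣≡2+m = sym (m+[n∸m]≡n 2≤p)

      bend : ∀ {v j} → IsUnit v → Shift (v ℤ.* step s) i j → Walk E N (s , j) (flip s , i)
      bend isUnit sh with directed s (2 + m) p {q} isUnit ∣p∣≡2+m b
      ... | q′ , ∣q′∣≡ , b′ = subst (λ ℓ → Walk E ℓ _ _)
        (trans (cong₂ _+_ (sym ∣p∣≡2+m) ∣q′∣≡) len) (bend-walk s (suc m) q′ isUnit b′ sh)

      through : ∀ {h j} → Shift (1ℤ ℤ.* step s) h i → Shift (1ℤ ℤ.* step s) i j → Walk E N (s , j) (s , h)
      through sh₁ sh₂ with directed s (2 + m) p {q} (inj₁ refl) ∣p∣≡2+m b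
      ... | q′ , ∣q′∣≡ , b′ = subst (λ ℓ → Walk E ℓ _ _)
        (trans (cong₂ _+_ (sym ∣p∣≡2+m) ∣q′∣≡) len) (through-walk s m q′ (inj₁ refl) b′ sh₁ sh₂)

      forth = proj₂ (shift (1ℤ ℤ.* step s) i)
      back = proj₂ (shift (-1ℤ ℤ.* step s) i)

      eq : ∀ c → ℤ.- (-1ℤ ℤ.* c) ≡ 1ℤ ℤ.* c
      eq = solve-∀

      across : Walk E N (nb (s , i) (F.suc F.zero)) (nb (s , i) (F.suc (F.suc F.zero)))
      across = through (shift-cast (eq (step s)) (shift-sym back)) forth

      rigid : Rigid (s , i)
      rigid F.zero F.zero c≢d = contradiction refl c≢d
      rigid F.zero (F.suc F.zero) _ = reverse E-sym (bend (inj₁ refl) forth)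
      rigid F.zero (F.suc (F.suc F.zero)) _ = reverse E-sym (bend (inj₂ refl) back)
      rigid (F.suc F.zero) F.zero _ = bend (inj₁ refl) forth
      rigid (F.suc F.zero) (F.suc F.zero) c≢d = contradiction refl c≢d
      rigid (F.suc F.zero) (F.suc (F.suc F.zero)) _ = across
      rigid (F.suc (F.suc F.zero)) F.zero _ = bend (inj₂ refl) back
      rigid (F.suc (F.suc F.zero)) (F.suc F.zero) _ = reverse E-sym across
      rigid (F.suc (F.suc F.zero)) (F.suc (F.suc F.zero)) c≢d = contradiction refl c≢d

    module _ {f : V → V} (endo : IsEndo E f) where

      star-map : V → Fin 3 → Fin 3
      star-map x c = proj₁ (nb-cover (endo (nb-edge x c)))

      nb-star-map : ∀ x c → nb (f x) (star-map x c) ≡ f (nb x c)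
      nb-star-map x c = proj₂ (nb-cover (endo (nb-edge x c)))

      -- If two neighbours had the same image, the image of the walk of length N between them would
      -- be closed.
      star-map-onto : ∀ {x} → Rigid x → ∀ d → ∃ λ c → star-map x c ≡ d
      star-map-onto {x} rigid = injective⇒surjective (λ c → c) (λ eq → eq) star-map-injective
        where
        star-map-injective : Injective _≡_ _≡_ (star-map x)
        star-map-injective {c} {d} eq = decidable-stable (c F.≟ d) λ c≢d →
          no-closed-N-walk (subst (Walk E N (f (nb x c)))
            (sym (trans (sym (nb-star-map x c)) (trans (cong (nb (f x)) eq) (nb-star-map x d))))
            (map-walk {f = f} endo {N} (rigid c d c≢d)))

      -- Distinct neighbours of `f x` come from distinct neighbours of x, and `f` carries along the
      -- walk that joins these.
      rigid-image : ∀ {x} → Rigid x → Rigid (f x)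
      rigid-image {x} rigid c d c≢d =
        let (c′ , c′↦c) = star-map-onto rigid c
            (d′ , d′↦d) = star-map-onto rigid d
        in subst₂ (Walk E N)
          (trans (sym (nb-star-map x c′)) (cong (nb (f x)) c′↦c))
          (trans (sym (nb-star-map x d′)) (cong (nb (f x)) d′↦d))
          (map-walk {f = f} endo {N} (rigid c′ d′ λ c′≡d′ →
            c≢d (trans (sym c′↦c) (trans (cong (star-map x) c′≡d′) d′↦d))))

      star-onto : ∀ {x} → Rigid x → ∀ {y} → E (f x) y → ∃ λ c → f (nb x c) ≡ y
      star-onto {x} rigid e =
        let (d , nb≡y) = nb-cover e
            (c , c↦d) = star-map-onto rigid d
        in c , trans (sym (nb-star-map x c)) (trans (cong (nb (f x)) c↦d) nb≡y)

    -- Rotations are endomorphisms, so they preserve rigidity, and they act transitively on each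
    -- side.
    rigid-everywhere : ∀ {s i} → Rigid (s , i) → ∀ j → Rigid (s , j)
    rigid-everywhere {s} {i} rigid j =
      let (c , eq) = rotate-to s i j
      in subst Rigid eq (rigid-image {f = rotate c} (rotate-endo c) rigid)

    -- Stars map onto stars, so the image is closed under adjacency, and the graph is connected.
    onto-if-all-rigid : ∀ {f} → IsEndo E f → (∀ x → Rigid x) → ∀ y → ∃ λ x → f x ≡ y
    onto-if-all-rigid {f} endo rigid y =
      connected (λ y → ∃ λ x → f x ≡ y)
        (λ { e (x , refl) → let (c , eq) = star-onto {f = f} endo (rigid x) e in nb x c , eq }) y (y , refl)

    module _ {f : V → V} (endo : IsEndo E f) {s : Side} (rigid : ∀ i → Rigid (s , i))
             (preserves : ∀ i → proj₁ (f (s , i)) ≡ s) where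

      private
        Hit : Fin n → Set
        Hit i = ∃ λ j → f (s , j) ≡ (s , i)

      preserves′ : ∀ {i y} → f (s , i) ≡ y → proj₁ y ≡ s
      preserves′ {i} refl = preserves i

      -- The star of (s , j) covers the star of (s , i). Its two rim vertices stay on side s, so
      -- only the mate can reach the other side.
      mate-of-hit : ∀ i j → f (s , j) ≡ (s , i) → f (flip s , j) ≡ (flip s , i)
      mate-of-hit i j eq = only-mate (proj₁ preimage) (proj₂ preimage)
        where
        preimage : ∃ λ c → f (nb (s , j) c) ≡ (flip s , i)
        preimage = star-onto {f = f} endo {s , j} (rigid j) {flip s , i}
          (subst (λ x → E x (flip s , i)) (sym eq) (spoke s i))

        only-mate : ∀ c → f (nb (s , j) c) ≡ (flip s , i) → f (flip s , j) ≡ (flip s , i)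
        only-mate F.zero eq = eq
        only-mate (F.suc F.zero) eq = contradiction (preserves′ eq) (flip≢ s)
        only-mate (F.suc (F.suc F.zero)) eq = contradiction (preserves′ eq) (flip≢ s)

      -- The mate of (s , j) is already sent to the other side, so the next rim vertex must be hit
      -- by a rim neighbour.
      hit-advance : ∀ {i i′} → Shift (step s) i i′ → Hit i → Hit i′
      hit-advance {i} {i′} sh (j , eq) = not-mate (proj₁ preimage) (proj₂ preimage)
        where
        preimage : ∃ λ c → f (nb (s , j) c) ≡ (s , i′)
        preimage = star-onto {f = f} endo {s , j} (rigid j) {s , i′}
          (subst (λ x → E x (s , i′)) (sym eq) (shift⇒edge s sh))

        not-mate : ∀ c → f (nb (s , j) c) ≡ (s , i′) → Hit i′
        not-mate F.zero eq′ = contradiction (cong proj₁ (trans (sym (mate-of-hit i j eq)) eq′)) (flip≢ s)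
        not-mate (F.suc F.zero) eq′ = _ , eq′
        not-mate (F.suc (F.suc F.zero)) eq′ = _ , eq′

      onto-if-preserving : Generates s → ∀ y → ∃ λ x → f x ≡ y
      onto-if-preserving gen (t , i) = onto t
        where
        hit : Hit i
        hit = side-connected s gen Hit hit-advance (proj₂ (f (s , i))) i
                (i , cong (_, proj₂ (f (s , i))) (preserves i))

        onto : ∀ t → ∃ λ x → f x ≡ (t , i)
        onto t with same⊎flip s t
        ... | inj₁ refl = _ , proj₂ hit
        ... | inj₂ refl = _ , mate-of-hit i (proj₁ hit) (proj₂ hit)

    -- A rigid vertex that changes sides has a rigid image there, and rotation makes that whole side
    -- rigid too. If no vertex of s changes sides, `f` preserves s.
    onto-if-side-rigid : ∀ {f} → IsEndo E f → ∀ s → (∀ i → Rigid (s , i)) → Generates s →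
      ∀ y → ∃ λ x → f x ≡ y
    onto-if-side-rigid {f} endo s rigid gen with F.any? (λ i → proj₁ (f (s , i)) ≟-side flip s)
      where
      _≟-side_ : (s t : Side) → Dec (s ≡ t)
      outer ≟-side outer = yes refl
      outer ≟-side inner = no λ ()
      inner ≟-side outer = no λ ()
      inner ≟-side inner = yes refl
    ... | yes (i , eq) = onto-if-all-rigid {f = f} endo all-rigid
      where
      all-rigid : ∀ x → Rigid x
      all-rigid (t , j) with same⊎flip s t
      ... | inj₁ refl = rigid j
      ... | inj₂ refl = rigid-everywhere (subst (λ t → Rigid (t , proj₂ (f (s , i)))) eq (rigid-image {f = f} endo (rigid i))) j
    ... | no stays = onto-if-preserving {f = f} endo rigid preserves gen
      where
      preserves : ∀ i → proj₁ (f (s , i)) ≡ s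
      preserves i with same⊎flip s (proj₁ (f (s , i)))
      ... | inj₁ eq = eq
      ... | inj₂ eq = contradiction (i , eq) stays

  -- The closed walk that takes p outer steps, a spoke, q inner steps and a spoke is a shortest odd
  -- closed walk.
  ShortestTwoSpoke : Set
  ShortestTwoSpoke = ∃₂ λ p q → Balanced outer p q × Odd (∣ p ∣ + ∣ q ∣) × NoShorterOddWalk E (2 + (∣ p ∣ + ∣ q ∣))

  shortestTwoSpoke⇒core : ShortestTwoSpoke → IsCore E
  shortestTwoSpoke⇒core (p , q , b , odd , min) f endo =
    surjective-endo⇒auto code code-injective endo onto
    where
    N = ∣ p ∣ + ∣ q ∣

    no-closed-N-walk : ∀ {x} → ¬ Walk E N x x
    no-closed-N-walk w = <⇒≱ (m<n+m N {2} z<s) (min N odd w)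

    open Rigidity N no-closed-N-walk

    -- With p = 0 the q inner steps alone would form a closed walk of length N.
    p≢0 : Fin n → p ≢ 0ℤ
    p≢0 i p≡0 = no-closed-N-walk (subst (λ ℓ → Walk E (ℓ + ∣ q ∣) (inner , i) (inner , i)) (sym (cong ∣_∣ p≡0))
      (side-walk inner q (shift-refl (≋-trans (≋-reflexive (trans (sym (ℤ.+-identityˡ (q ℤ.* + k)))
        (cong (λ z → z ℤ.* 1ℤ ℤ.+ q ℤ.* + k) (sym p≡0)))) b))))

    q≢0 : Fin n → q ≢ 0ℤ
    q≢0 i q≡0 = no-closed-N-walk (subst (λ ℓ → Walk E ℓ (outer , i) (outer , i))
      (trans (sym (+-identityʳ ∣ p ∣)) (cong (λ z → ∣ p ∣ + ∣ z ∣) (sym q≡0)))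
      (side-walk outer p (shift-refl (≋-trans (≋-reflexive (trans (sym (ℤ.+-identityʳ (p ℤ.* 1ℤ)))
        (cong (λ z → p ℤ.* 1ℤ ℤ.+ z ℤ.* + k) (sym q≡0)))) b))))

    -- If p is 1 or -1, balance says that q is an inverse of k modulo n up to sign.
    inner-generates : IsUnit p → Generates inner
    inner-generates (inj₁ p≡1) = ℤ.- q , ≋-linear₁ -1ℤ b
      (trans (eq q (+ k)) (cong (λ z → -1ℤ ℤ.* ((z ℤ.* 1ℤ ℤ.+ q ℤ.* + k) ℤ.- 0ℤ)) (sym p≡1)))
      where
      eq : ∀ q k → ℤ.- q ℤ.* k ℤ.- 1ℤ ≡ -1ℤ ℤ.* ((1ℤ ℤ.* 1ℤ ℤ.+ q ℤ.* k) ℤ.- 0ℤ)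
      eq = solve-∀
    inner-generates (inj₂ p≡-1) = q , ≋-linear₁ 1ℤ b
      (trans (eq q (+ k)) (cong (λ z → 1ℤ ℤ.* ((z ℤ.* 1ℤ ℤ.+ q ℤ.* + k) ℤ.- 0ℤ)) (sym p≡-1)))
      where
      eq : ∀ q k → q ℤ.* k ℤ.- 1ℤ ≡ 1ℤ ℤ.* ((-1ℤ ℤ.* 1ℤ ℤ.+ q ℤ.* k) ℤ.- 0ℤ)
      eq = solve-∀

    onto : ∀ y → ∃ λ x → f x ≡ y
    onto y@(_ , i) with zero⊎unit⊎large p | zero⊎unit⊎large q
    ... | inj₁ p≡0 | _ = contradiction p≡0 (p≢0 i)
    ... | inj₂ (inj₂ 2≤∣p∣) | _ = onto-if-side-rigid {f = f} endo outer (rigid-side outer p q b refl 2≤∣p∣) outer-generates y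
    ... | inj₂ (inj₁ _) | inj₁ q≡0 = contradiction q≡0 (q≢0 i)
    -- Here N = 2, which is not odd.
    ... | inj₂ (inj₁ unit-p) | inj₂ (inj₁ unit-q) = contradiction (divides 1 (cong₂ _+_ (∣unit∣ unit-p) (∣unit∣ unit-q))) odd
    ... | inj₂ (inj₁ unit-p) | inj₂ (inj₂ 2≤∣q∣) = onto-if-side-rigid {f = f} endo inner
      (rigid-side inner q p (balanced-flip outer {p} {q} b) (+-comm ∣ q ∣ ∣ p ∣) 2≤∣q∣) (inner-generates unit-p) y

-- Shortest odd cycles and two-spoke walks

least : ∀ {P : ℕ → Set} → (∀ N → Dec (P N)) → ∀ N → P N → ∃ λ M → P M × (∀ M′ → P M′ → M ≤ M′)
least {P} P? = <-rec (λ N → P N → ∃ λ M → P M × (∀ M′ → P M′ → M ≤ M′)) descend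
  where
  descend : ∀ N → (∀ {M} → M < N → P M → ∃ λ M → P M × (∀ M′ → P M′ → M ≤ M′)) →
    P N → ∃ λ M → P M × (∀ M′ → P M′ → M ≤ M′)
  descend N rec PN with anyUpTo? P? N
  ... | yes (M , M<N , PM) = rec M<N PM
  ... | no none = N , PN , λ M′ PM′ → ≮⇒≥ λ M′<N → none (M′ , M′<N , PM′)

module TwoSpoke (n k : ℕ) .{{_ : NonZero n}} (0<k : 0 < k) (2k<n : 2 * k < n) where
  open Endomorphisms n k public

  loopless : ∀ {x} → ¬ E x x
  loopless {s , i} e with edge⁻ e
  ... | inj₁ (s≡flip , _) = flip≢ s (sym s≡flip)
  ... | inj₂ (_ , u , isUnit , sh) = <⇒≱ (step<n s) (∣⇒≤ {{step-nonZero s}} (subst (n ∣_) (abs-step s isUnit) (≋0⇒∣ (shift-loop sh))))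
    where
    k<n : k < n
    k<n = ≤-<-trans (m≤m+n k (k + 0)) 2k<n
    step<n : ∀ s → ∣ step s ∣ < n
    step<n outer = ≤-<-trans 0<k k<n
    step<n inner = k<n
    step-nonZero : ∀ s → NonZero (∣ step s ∣)
    step-nonZero outer = _
    step-nonZero inner = >-nonZero 0<k
    abs-step : ∀ s {u} → IsUnit u → ∣ u ℤ.* step s ∣ ≡ ∣ step s ∣
    abs-step s {u} isUnit = trans (ℤ.abs-* u (step s))
      (trans (cong (_* ∣ step s ∣) (∣unit∣ isUnit)) (*-identityˡ ∣ step s ∣))

  _≟-vertex_ : DecidableEquality V
  (s , i) ≟-vertex (t , j) with same⊎flip s t | i F.≟ j
  ... | inj₁ refl | yes refl = yes refl
  ... | inj₁ refl | no i≢j = no λ { refl → i≢j refl }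
  ... | inj₂ refl | _ = no λ eq → flip≢ s (sym (cong proj₁ eq))

  balanced-outer : ∀ s {p q} → Balanced s p q →
    ∃₂ λ p′ q′ → Balanced outer p′ q′ × ∣ p′ ∣ + ∣ q′ ∣ ≡ ∣ p ∣ + ∣ q ∣
  balanced-outer outer {p} {q} b = p , q , b , refl
  balanced-outer inner {p} {q} b = q , p , balanced-flip inner {p} {q} b , +-comm ∣ q ∣ ∣ p ∣

  -- The walk back ends on the other side at the same index, so its trace is a `crossing`, and its
  -- displacement vanishes modulo n.
  return-through-spoke : ∀ {ℓ x y} → E x y → proj₁ x ≢ proj₁ y → Walk E ℓ y x →
    ∃₂ λ p q → Balanced outer p q × ∃ λ c → suc ℓ ≡ 2 + (∣ p ∣ + ∣ q ∣) + 2 * c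
  return-through-spoke {ℓ} {s , i} {t , j} e s≢t w with edge⁻ e
  ... | inj₂ (t≡s , _) = contradiction (sym t≡s) s≢t
  ... | inj₁ (_ , refl) with trace w
  ...   | straight _ _ _ _ = contradiction refl s≢t
  ...   | returning _ _ _ _ _ = contradiction refl s≢t
  ...   | crossing p q c _ len sh =
    let (p′ , q′ , b , sum) = balanced-outer t {p} {q} (shift-loop sh)
    in p′ , q′ , b , c , trans (cong suc (sym len)) (trans (eq (∣ p ∣ + ∣ q ∣) (2 * c)) (cong (λ N → 2 + N + 2 * c) (sym sum)))
    where
    eq : ∀ N c → suc (N + suc c) ≡ 2 + N + c
    eq = ℕ-solve-∀

  odd-N : ∀ {L} N c → L ≡ 2 + N + 2 * c → Odd L → Odd N
  odd-N N c refl oddL evenN = oddL (∣m∣n⇒∣m+n (∣m∣n⇒∣m+n (∣-refl {2}) evenN) (m∣m*n c))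

  -- Opening the cycle at its spoke gives p and q with |p| + |q| + 2 of the same parity as the
  -- length and not larger, so minimality carries over.
  hasSpoke⇒shortestTwoSpoke : SomeMinOddCycleHasSpoke n k → ShortestTwoSpoke
  hasSpoke⇒shortestTwoSpoke (zero , C , odd , _) = contradiction (2 ∣0) odd
  hasSpoke⇒shortestTwoSpoke (suc L , C , odd , min , i , isSpoke) =
    let (p , q , b , c , len) = return-through-spoke (closed C i) isSpoke (cycle-return C i)
        N = ∣ p ∣ + ∣ q ∣
    in p , q , b , odd-N N c len odd , λ ℓ oddℓ w →
      ≤-trans (m≤m+n (2 + N) (2 * c)) (subst (_≤ ℓ) len
        (minimal-cycle⇒minimal-walk loopless _≟-vertex_ min ℓ oddℓ w))

  shortestTwoSpoke⇒hasSpoke : ShortestTwoSpoke → SomeMinOddCycleHasSpoke n k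
  shortestTwoSpoke⇒hasSpoke (p , q , b , odd , min) =
    L , proj₁ cycle , oddL , minimal , F.zero , isSpoke (proj₁ (proj₂ cycle)) (proj₂ (proj₂ cycle))
    where
    L = suc (∣ p ∣ + suc (∣ q ∣))

    L≡2+N : L ≡ 2 + (∣ p ∣ + ∣ q ∣)
    L≡2+N = cong suc (+-suc ∣ p ∣ ∣ q ∣)

    oddL : Odd L
    oddL even = odd (∣m+n∣m⇒∣n (subst (2 ∣_) L≡2+N even) (∣-refl {2}))

    i = proj₁ (residue 0ℤ)
    l = proj₁ (shift (p ℤ.* 1ℤ) i)
    i→l = proj₂ (shift (p ℤ.* 1ℤ) i)

    l→i : Shift (q ℤ.* + k) l i
    l→i = shift-resp (≋-linear₁ -1ℤ b (eq (p ℤ.* 1ℤ) (q ℤ.* + k))) (shift-sym i→l)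
      where
      eq : ∀ x y → ℤ.- x ℤ.- y ≡ -1ℤ ℤ.* ((x ℤ.+ y) ℤ.- 0ℤ)
      eq = solve-∀

    tail : Walk E (∣ p ∣ + suc (∣ q ∣)) (outer , i) (inner , i)
    tail = _++_ {a = ∣ p ∣} {b = suc (∣ q ∣)} (side-walk outer p i→l) ((inner , l) , spoke outer l , side-walk inner q l→i)

    cycle : Σ (Cycle E L) λ C → vtx C F.zero ≡ (inner , i) × vtx C (next F.zero) ≡ (outer , i)
    cycle = minimal⇒cycle-from loopless oddL (λ ℓ o v → subst (_≤ ℓ) (sym L≡2+N) (min ℓ o v)) (spoke inner i) tail

    minimal : ∀ L′ → Cycle E L′ → Odd L′ → L ≤ L′
    minimal zero _ odd′ = contradiction (2 ∣0) odd′
    minimal (suc L′) C′ odd′ = subst (_≤ suc L′) (sym L≡2+N)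
      (min (suc L′) odd′ (vtx C′ (next F.zero) , closed C′ F.zero , cycle-return C′ F.zero))

    inner≢outer : inner ≢ outer
    inner≢outer ()

    isSpoke : ∀ {x y} → x ≡ (inner , i) → y ≡ (outer , i) → IsSpoke x y
    isSpoke x≡ y≡ same = inner≢outer (trans (sym (cong proj₁ x≡)) (trans same (cong proj₁ y≡)))

  ∣⇒≋0 : ∀ {z} → n ∣ ∣ z ∣ → z ≋ 0ℤ
  ∣⇒≋0 {+ z} (divides t eq) = + t , trans (ℤ.+-identityʳ (+ z)) (trans (cong +_ eq) (ℤ.pos-* t n))
  ∣⇒≋0 { -[1+ z ]} (divides t eq) = ℤ.- + t , trans (ℤ.+-identityʳ -[1+ z ])
    (trans (cong (λ y → ℤ.- + y) eq) (trans (cong ℤ.-_ (ℤ.pos-* t n)) (ℤ.neg-distribˡ-* (+ t) (+ n))))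

  Span : ℕ → Set
  Span N = Odd N × ∃₂ λ p q → Balanced outer p q × ∣ p ∣ + ∣ q ∣ ≡ N

  balanced? : ∀ p q → Dec (Balanced outer p q)
  balanced? p q = Dec.map′ ∣⇒≋0 ≋0⇒∣ (n ∣? ∣ p ℤ.* 1ℤ ℤ.+ q ℤ.* + k ∣)

  -- Negating the pair makes p nonnegative. Then p is at most N and q is N - p up to sign, so the
  -- search is finite.
  span? : ∀ N → Dec (Span N)
  span? N = ¬? (2 ∣? N) ×-dec Dec.map′ from to
      (F.any? λ (a : Fin (suc N)) →
        balanced? (+ toℕ a) (+ (N ∸ toℕ a)) ⊎-dec balanced? (+ toℕ a) (ℤ.- + (N ∸ toℕ a)))
    where
    PositiveSpan = ∃ λ (a : Fin (suc N)) →
      Balanced outer (+ toℕ a) (+ (N ∸ toℕ a)) ⊎ Balanced outer (+ toℕ a) (ℤ.- + (N ∸ toℕ a))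

    from : PositiveSpan → ∃₂ λ p q → Balanced outer p q × ∣ p ∣ + ∣ q ∣ ≡ N
    from (a , inj₁ b) = + toℕ a , + (N ∸ toℕ a) , b , m+[n∸m]≡n (F.toℕ≤pred[n] a)
    from (a , inj₂ b) = + toℕ a , ℤ.- + (N ∸ toℕ a) , b , trans (cong (λ z → toℕ a + z) (ℤ.∣-i∣≡∣i∣ (+ (N ∸ toℕ a)))) (m+[n∸m]≡n (F.toℕ≤pred[n] a))

    positive : ∀ a q → Balanced outer (+ a) q → a + ∣ q ∣ ≡ N → PositiveSpan
    positive a q b sum = fromℕ< a<1+N , signed q b (sym (trans (cong (N ∸_) toℕ≡a) (trans (cong (_∸ a) (sym sum)) (m+n∸m≡n a ∣ q ∣))))
      where
      a<1+N : a < suc N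
      a<1+N = s≤s (subst (a ≤_) sum (m≤m+n a ∣ q ∣))
      toℕ≡a = F.toℕ-fromℕ< a<1+N
      signed : ∀ q → Balanced outer (+ a) q → ∣ q ∣ ≡ N ∸ toℕ (fromℕ< a<1+N) →
        Balanced outer (+ toℕ (fromℕ< a<1+N)) (+ (N ∸ toℕ (fromℕ< a<1+N)))
        ⊎ Balanced outer (+ toℕ (fromℕ< a<1+N)) (ℤ.- + (N ∸ toℕ (fromℕ< a<1+N)))
      signed (+ q) b eq = inj₁ (subst₂ (λ x y → Balanced outer (+ x) (+ y)) (sym toℕ≡a) eq b)
      signed -[1+ q ] b eq = inj₂ (subst₂ (λ x y → Balanced outer (+ x) (ℤ.- + y)) (sym toℕ≡a) eq b)

    to : (∃₂ λ p q → Balanced outer p q × ∣ p ∣ + ∣ q ∣ ≡ N) → PositiveSpan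
    to (+ a , q , b , sum) = positive a q b sum
    to (-[1+ a ] , q , b , sum) = positive (suc a) (ℤ.- q) (balanced-neg outer { -[1+ a ]} {q} b)
      (trans (cong (λ z → suc a + z) (ℤ.∣-i∣≡∣i∣ q)) sum)

  -- A lower bound for odd closed walks without spokes, in terms of their `straight` traces.
  SpokelessOddWalk≥ : ℕ → Set
  SpokelessOddWalk≥ b = ∀ s p c → p ℤ.* step s ≋ 0ℤ → Odd (∣ p ∣ + 2 * c) → b ≤ ∣ p ∣ + 2 * c

  -- Choose |p| + |q| = M least among odd values, so M ≤ N. A closed walk with spokes has length at
  -- least 2 + M by its trace, and one without by the hypothesis.
  shortestTwoSpoke : ∀ {N} → Span N → SpokelessOddWalk≥ (2 + N) → ShortestTwoSpoke
  shortestTwoSpoke {N} spanN spokeless with least span? N spanN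
  ... | M , (oddM , p , q , b , refl) , least-M = p , q , b , oddM , shortest
    where
    two-spoke : ∀ {ℓ} s p q c → Odd ℓ → Balanced s p q → ℓ ≡ 2 + (∣ p ∣ + ∣ q ∣) + 2 * c → 2 + M ≤ ℓ
    two-spoke s p q c odd b refl =
      let (p′ , q′ , b′ , sum) = balanced-outer s {p} {q} b
      in ≤-trans (+-monoʳ-≤ 2 (least-M (∣ p ∣ + ∣ q ∣) (odd-N (∣ p ∣ + ∣ q ∣) c refl odd , p′ , q′ , b′ , sum)))
                 (m≤m+n (2 + (∣ p ∣ + ∣ q ∣)) (2 * c))

    shortest : NoShorterOddWalk E (2 + M)
    shortest ℓ {s , i} odd w with trace w
    ... | straight p c refl sh = ≤-trans (+-monoʳ-≤ 2 (least-M N spanN)) (spokeless s p c (shift-loop sh) odd)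
    ... | crossing _ _ _ s≡flip _ _ = contradiction (sym s≡flip) (flip≢ s)
    ... | returning p q c len sh = two-spoke s p q c odd (shift-loop sh) (trans (sym len) (eq (∣ p ∣ + ∣ q ∣) (2 * c)))
      where
      eq : ∀ N c → N + (2 + c) ≡ 2 + N + c
      eq = ℕ-solve-∀

-- A bipartition for even n and odd k

module _ {n k : ℕ} .{{_ : NonZero n}} (even-n : Even n) (odd-k : Odd k) where

  private
    even? : ℕ → Bool
    even? a = [ (λ _ → true) , (λ _ → false) ]′ (even⊎odd a)

    -- Odd steps change the parity of the index, and reduction modulo an even n keeps it. Spokes
    -- keep the index, so the inner side takes the opposite colours.
    color : GPVertex n → Bool
    color (outer , i) = even? (toℕ i)
    color (inner , i) = not (even? (toℕ i))

    step-parity : ∀ {c} {i j : Fin n} → Odd c → StepMod n c i j → even? (toℕ i) ≢ even? (toℕ j)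
    step-parity {c} {i} {j} odd-c eq with even⊎odd (toℕ i) | even⊎odd (toℕ j)
    ... | inj₁ ei | inj₂ oj = λ ()
    ... | inj₂ oi | inj₁ ej = λ ()
    ... | inj₁ ei | inj₁ ej = λ _ → odd-c (∣m+n∣m⇒∣n (∣n∣m%n⇒∣m even-n (subst (2 ∣_) (sym eq) ej)) ei)
    ... | inj₂ oi | inj₂ oj = λ _ → even-suc⇒odd oj (subst (2 ∣_) eq (%-presˡ-∣ (odd+odd (even-suc⇒odd oi) odd-c) even-n))

    odd-1 : Odd 1
    odd-1 = even-suc⇒odd ∣-refl

    proper : ∀ {x y} → GPAdj n k x y → color x ≢ color y
    proper {outer , _} {outer , _} (inj₁ e) eq = step-parity odd-1 e eq
    proper {outer , _} {outer , _} (inj₂ e) eq = step-parity odd-1 e (sym eq)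
    proper {inner , _} {inner , _} (inj₁ e) eq = step-parity odd-k e (not-injective eq)
    proper {inner , _} {inner , _} (inj₂ e) eq = step-parity odd-k e (not-injective (sym eq))
    proper {outer , _} {inner , _} refl = not-¬ refl
    proper {inner , _} {outer , _} refl eq = not-¬ refl (sym eq)

  bipartite : IsBipartite (GPAdj n k)
  bipartite = color , proper

-- Arithmetic of the conditions on a, d and m

half-difference : ∀ {a D h e} → a + D ≡ h * 2 → e + h ≡ D → a + 2 * e ≡ D
half-difference {a} {D} {h} {e} a+D≡h2 e+h≡D = +-cancelʳ-≡ D (a + 2 * e) D (begin
  a + 2 * e + D       ≡⟨ regroup a (2 * e) D ⟩
  (a + D) + 2 * e     ≡⟨ cong (_+ 2 * e) a+D≡h2 ⟩
  h * 2 + 2 * e       ≡⟨ factor h e ⟩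
  (e + h) + (e + h)   ≡⟨ cong₂ _+_ e+h≡D e+h≡D ⟩
  D + D               ∎)
  where
  open ≡-Reasoning
  regroup : ∀ a x D → a + x + D ≡ (a + D) + x
  regroup = ℕ-solve-∀
  factor : ∀ h e → h * 2 + 2 * e ≡ (e + h) + (e + h)
  factor = ℕ-solve-∀

-- The form b = d - 2 e with 0 ≤ e ≤ d says both that |b| ≤ d and that b has the parity of d; e will
-- count the descents among d unit steps.
module Flat {d e : ℕ} {b : ℤ} (e≤d : e ≤ d) (b+2e≡d : b ℤ.+ + (2 * e) ≡ + d) where

  private
    split-sign : (∃ λ β → ∣ b ∣ ≡ β × d ≡ β + 2 * e) ⊎ (∃ λ β → ∣ b ∣ ≡ β × d + β ≡ 2 * e)
    split-sign = sign b (sym b+2e≡d)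
      where
      eq : ∀ x y → (ℤ.- x ℤ.+ y) ℤ.+ x ≡ y
      eq = solve-∀
      sign : ∀ b → + d ≡ b ℤ.+ + (2 * e) → (∃ λ β → ∣ b ∣ ≡ β × d ≡ β + 2 * e) ⊎ (∃ λ β → ∣ b ∣ ≡ β × d + β ≡ 2 * e)
      sign (+ β) h = inj₁ (β , refl , ℤ.+-injective h)
      sign -[1+ β ] h = inj₂ (suc β , refl , ℤ.+-injective (trans (cong (ℤ._+ + suc β) h) (eq (+ suc β) (+ (2 * e)))))

  ∣b∣≤d : ∣ b ∣ ≤ d
  ∣b∣≤d with split-sign
  ... | inj₁ (β , refl , h) = subst (β ≤_) (sym h) (m≤m+n β (2 * e))
  ... | inj₂ (β , refl , h) = +-cancelˡ-≤ d β d (subst (_≤ d + d) (sym h)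
          (subst (λ x → 2 * e ≤ d + x) (+-identityʳ d) (*-monoʳ-≤ 2 e≤d)))

  even-d+∣b∣ : Even (d + ∣ b ∣)
  even-d+∣b∣ with split-sign
  ... | inj₁ (β , refl , h) = divides (β + e) (trans (cong (_+ β) h) (eq β e))
    where
    eq : ∀ β e → β + 2 * e + β ≡ (β + e) * 2
    eq = ℕ-solve-∀
  ... | inj₂ (β , refl , h) = divides e (trans h (*-comm 2 e))

module Characterization (n k : ℕ) .{{_ : NonZero n}} (0<k : 0 < k) (2k<n : 2 * k < n)
    (m d k′ a : ℕ) {{_ : NonZero d}} (n≡md : n ≡ m * d) (k≡k′d : k ≡ k′ * d) (a<m : a < m) where
  open TwoSpoke n k 0<k 2k<n public

  FirstCase SecondCase : Set
  FirstCase = Even (a + d) × d + 2 ≤ a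
  SecondCase = Odd (a + d) × a + d + 2 ≤ m

  -- The remaining case for odd m: some representative b of a modulo m satisfies |b| ≤ d and b ≡ d
  -- modulo 2.
  FlatCase : Set
  FlatCase = ∃₂ λ e b → e ≤ d × b ℤ.+ + (2 * e) ≡ + d × b ℤ.* + k ≋ + d

  module _ (ak≋d : + a ℤ.* + k ≋ + d) where

    mk≋0 : + m ℤ.* + k ≋ 0ℤ
    mk≋0 = ∣⇒≋0 (subst (n ∣_) (sym (trans (ℤ.abs-* (+ m) (+ k)) (trans (cong (m *_) k≡k′d) (trans (eq m k′ d) (cong (k′ *_) (sym n≡md)))))) (n∣m*n k′))
      where
      eq : ∀ m k d → m * (k * d) ≡ k * (m * d)
      eq = ℕ-solve-∀

    n∣zd⇒m∣z : ∀ z → z ℤ.* + d ≋ 0ℤ → m ∣ ∣ z ∣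
    n∣zd⇒m∣z z zd≋0 = *-cancelʳ-∣ d (subst₂ _∣_ n≡md (ℤ.abs-* z (+ d)) (≋0⇒∣ zd≋0))

    -- On the inner side, multiplying p k ≡ 0 by a gives p d ≡ 0 modulo n = m d.
    side-period : ∀ s p → p ℤ.* step s ≋ 0ℤ → m ∣ ∣ p ∣
    side-period outer p p≋0 = ∣-trans (divides d (trans n≡md (*-comm m d))) (subst (λ z → n ∣ ∣ z ∣) (ℤ.*-identityʳ p) (≋0⇒∣ p≋0))
    side-period inner p pk≋0 = n∣zd⇒m∣z p (≋-linear₂ (ℤ.- p) (+ a) ak≋d pk≋0 (eq p (+ d) (+ a) (+ k)))
      where
      eq : ∀ p d a k → p ℤ.* d ℤ.- 0ℤ ≡ ℤ.- p ℤ.* (a ℤ.* k ℤ.- d) ℤ.+ a ℤ.* (p ℤ.* k ℤ.- 0ℤ)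
      eq = solve-∀

    -- For even a + d take b = a, which is small enough unless a ≥ d + 2. For odd a + d the oddness
    -- of m gives a - m the parity of d, and m - a ≤ d unless a + d + 2 ≤ m.
    trichotomy : Odd m → FirstCase ⊎ SecondCase ⊎ FlatCase
    trichotomy odd-m with 2 ∣? (a + d)
    trichotomy odd-m | yes even@(divides h a+d≡h2) with h ≤? d
    ... | yes h≤d = inj₂ (inj₂ (d ∸ h , + a , m∸n≤m d h ,
            cong +_ (half-difference {a} {d} {h} {d ∸ h} a+d≡h2 (m∸n+n≡m h≤d)) , ak≋d))
    ... | no h≰d = inj₁ (even , +-cancelʳ-≤ d (d + 2) a (subst₂ _≤_ (eq d) (sym a+d≡h2) (*-monoˡ-≤ 2 (≰⇒> h≰d))))
      where
      eq : ∀ d → suc d * 2 ≡ d + 2 + d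
      eq = ℕ-solve-∀
    trichotomy odd-m | no odd with odd+odd odd odd-m
    ... | divides h a+d+m≡h2 with m ≤? h
    -- As h is half of a + d + m, the number d + m - h is half of d - (a - m); it is at most d
    -- exactly when m ≤ h.
    ...   | yes m≤h = inj₂ (inj₂ (d + m ∸ h , + a ℤ.- + m ,
              subst (d + m ∸ h ≤_) (m+n∸n≡m d m) (∸-monoʳ-≤ (d + m) m≤h) , sum , [a-m]k≋d))
      where
      a+[d+m]≡h2 : a + (d + m) ≡ h * 2
      a+[d+m]≡h2 = trans (sym (+-assoc a d m)) a+d+m≡h2

      h≤d+m : h ≤ d + m
      h≤d+m = *-cancelʳ-≤ h (d + m) 2 (subst₂ _≤_ a+[d+m]≡h2 (eq (d + m))
                (+-monoˡ-≤ (d + m) (≤-trans (<⇒≤ a<m) (m≤n+m m d))))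
        where
        eq : ∀ x → x + x ≡ x * 2
        eq = ℕ-solve-∀

      sum : (+ a ℤ.- + m) ℤ.+ + (2 * (d + m ∸ h)) ≡ + d
      sum = trans (move (+ a) (+ m) (+ (2 * (d + m ∸ h))))
        (trans (cong (λ x → + x ℤ.- + m) (half-difference {a} {d + m} {h} {d + m ∸ h} a+[d+m]≡h2 (m∸n+n≡m h≤d+m))) (cancel (+ d) (+ m)))
        where
        move : ∀ a m x → (a ℤ.- m) ℤ.+ x ≡ (a ℤ.+ x) ℤ.- m
        move = solve-∀
        cancel : ∀ d m → (d ℤ.+ m) ℤ.- m ≡ d
        cancel = solve-∀

      [a-m]k≋d : (+ a ℤ.- + m) ℤ.* + k ≋ + d
      [a-m]k≋d = ≋-linear₂ 1ℤ -1ℤ ak≋d mk≋0 (eq (+ a) (+ m) (+ k) (+ d))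
        where
        eq : ∀ a m k d → (a ℤ.- m) ℤ.* k ℤ.- d ≡ 1ℤ ℤ.* (a ℤ.* k ℤ.- d) ℤ.+ -1ℤ ℤ.* (m ℤ.* k ℤ.- 0ℤ)
        eq = solve-∀
    ...   | no m≰h = inj₂ (inj₁ (odd , +-cancelʳ-≤ m (a + d + 2) m
              (subst₂ _≤_ (trans (cong (λ x → 2 + x) (sym a+d+m≡h2)) (regroup (a + d) m)) (eq m) (*-monoˡ-≤ 2 (≰⇒> m≰h)))))
      where
      regroup : ∀ x m → 2 + (x + m) ≡ x + 2 + m
      regroup = ℕ-solve-∀
      eq : ∀ m → m * 2 ≡ m + m
      eq = ℕ-solve-∀

    flat⇒¬shortestTwoSpoke : Odd m → FlatCase → ¬ ShortestTwoSpoke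
    flat⇒¬shortestTwoSpoke odd-m (e , b , e≤d , b+2e≡d , bk≋d) (p , q , bal@(t , pq≡tn) , odd , min) =
      <⇒≱ (m<n+m N {2} z<s) (≤-trans 2+N≤m m≤N)
      where
      open Flat {b = b} e≤d b+2e≡d
      N = ∣ p ∣ + ∣ q ∣

      2+N≤m : 2 + N ≤ m
      2+N≤m = min m odd-m (side-walk inner (+ m) {proj₁ (residue 0ℤ)} (shift-refl mk≋0))

      -- This is p + q k = t n divided by d and solved for p / d.
      p′ = t ℤ.* + m ℤ.- q ℤ.* + k′

      p≡p′d : p ≡ p′ ℤ.* + d
      p≡p′d = begin
        p                                                          ≡⟨ isolate p q (+ k) ⟩
        ((p ℤ.* 1ℤ ℤ.+ q ℤ.* + k) ℤ.- 0ℤ) ℤ.- q ℤ.* + k            ≡⟨ cong (ℤ._- q ℤ.* + k) pq≡tn ⟩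
        t ℤ.* + n ℤ.- q ℤ.* + k                                    ≡⟨ cong₂ (λ x y → t ℤ.* x ℤ.- q ℤ.* y) (trans (cong +_ n≡md) (ℤ.pos-* m d)) (trans (cong +_ k≡k′d) (ℤ.pos-* k′ d)) ⟩
        t ℤ.* (+ m ℤ.* + d) ℤ.- q ℤ.* (+ k′ ℤ.* + d)               ≡⟨ factor t (+ m) (+ d) q (+ k′) ⟩
        p′ ℤ.* + d                                                 ∎
        where
        open ≡-Reasoning
        isolate : ∀ p q k → p ≡ ((p ℤ.* 1ℤ ℤ.+ q ℤ.* k) ℤ.- 0ℤ) ℤ.- q ℤ.* k
        isolate = solve-∀
        factor : ∀ t m d q k → t ℤ.* (m ℤ.* d) ℤ.- q ℤ.* (k ℤ.* d) ≡ (t ℤ.* m ℤ.- q ℤ.* k) ℤ.* d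
        factor = solve-∀

      ∣p∣≡ : ∣ p ∣ ≡ ∣ p′ ∣ * d
      ∣p∣≡ = trans (cong ∣_∣ p≡p′d) (ℤ.abs-* p′ (+ d))

      z = b ℤ.* p′ ℤ.+ q

      -- Modulo n, z d = b p + q d ≡ b (p + q k) ≡ 0, because d ≡ b k.
      m∣z : m ∣ ∣ z ∣
      m∣z = n∣zd⇒m∣z z (≋-trans (≋-reflexive (trans (expand b p′ q (+ d)) (cong (λ x → b ℤ.* x ℤ.+ q ℤ.* + d) (sym p≡p′d))))
              (≋-linear₂ b (ℤ.- q) bal bk≋d (eq b p q (+ d) (+ k))))
        where
        expand : ∀ b p q d → (b ℤ.* p ℤ.+ q) ℤ.* d ≡ b ℤ.* (p ℤ.* d) ℤ.+ q ℤ.* d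
        expand = solve-∀
        eq : ∀ b p q d k → (b ℤ.* p ℤ.+ q ℤ.* d) ℤ.- 0ℤ
             ≡ b ℤ.* ((p ℤ.* 1ℤ ℤ.+ q ℤ.* k) ℤ.- 0ℤ) ℤ.+ ℤ.- q ℤ.* (b ℤ.* k ℤ.- d)
        eq = solve-∀

      -- If z = 0, then |q| = |b| |p′| and N = |p′| (d + |b|), which is even.
      z≢0 : z ≢ 0ℤ
      z≢0 z≡0 = odd (subst (2 ∣_) (sym (trans (cong₂ _+_ ∣p∣≡ ∣q∣≡) (eq (∣ p′ ∣) d (∣ b ∣)))) (∣n⇒∣m*n (∣ p′ ∣) even-d+∣b∣))
        where
        solved : ∀ x q → q ≡ ℤ.- x ℤ.+ (x ℤ.+ q)
        solved = solve-∀
        ∣q∣≡ : ∣ q ∣ ≡ ∣ b ∣ * ∣ p′ ∣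
        ∣q∣≡ = trans (cong ∣_∣ (trans (solved (b ℤ.* p′) q) (trans (cong (λ x → ℤ.- (b ℤ.* p′) ℤ.+ x) z≡0) (ℤ.+-identityʳ (ℤ.- (b ℤ.* p′))))))
                 (trans (ℤ.∣-i∣≡∣i∣ (b ℤ.* p′)) (ℤ.abs-* b p′))
        eq : ∀ p d b → p * d + b * p ≡ p * (d + b)
        eq = ℕ-solve-∀

      m≤N : m ≤ N
      m≤N = begin
        m                            ≤⟨ ∣⇒≤ {{≢-nonZero (z≢0 ∘ ℤ.∣i∣≡0⇒i≡0)}} m∣z ⟩
        ∣ z ∣                        ≤⟨ ℤ.∣i+j∣≤∣i∣+∣j∣ (b ℤ.* p′) q ⟩
        ∣ b ℤ.* p′ ∣ + ∣ q ∣         ≡⟨ cong (_+ ∣ q ∣) (ℤ.abs-* b p′) ⟩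
        ∣ b ∣ * ∣ p′ ∣ + ∣ q ∣       ≤⟨ +-monoˡ-≤ (∣ q ∣) (*-monoˡ-≤ (∣ p′ ∣) ∣b∣≤d) ⟩
        d * ∣ p′ ∣ + ∣ q ∣           ≡⟨ cong (_+ ∣ q ∣) (trans (*-comm d (∣ p′ ∣)) (sym ∣p∣≡)) ⟩
        N                            ∎
        where open ≤-Reasoning

-- The homomorphism into the inner side

module Retraction (n k : ℕ) .{{_ : NonZero n}} (m d k′ : ℕ) {{_ : NonZero d}}
    (n≡md : n ≡ m * d) (k≡k′d : k ≡ k′ * d)
    (e : ℕ) (b : ℤ) (e≤d : e ≤ d) (b+2e≡d : b ℤ.+ + (2 * e) ≡ + d) where
  open Endomorphisms n k

  residue-rise : ℕ → ℤ
  residue-rise r with r <? e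
  ... | yes _ = -1ℤ
  ... | no _ = 1ℤ

  residue-rise-unit : ∀ r → IsUnit (residue-rise r)
  residue-rise-unit r with r <? e
  ... | yes _ = inj₂ refl
  ... | no _ = inj₁ refl

  rise : ℕ → ℤ
  rise i = residue-rise (i % d)

  -- A walk on the integers that rises by d - 2 e = b over every d steps.
  height : ℕ → ℤ
  height zero = 0ℤ
  height (suc i) = rise i ℤ.+ height i

  rise-periodic : ∀ i → rise (i + d) ≡ rise i
  rise-periodic i = cong residue-rise ([m+n]%n≡m%n i d)

  -- The descents come first in each block of d steps, so r steps contain `r ⊓ e` of them.
  height-before-d : ∀ r → r ≤ d → height r ≡ + r ℤ.- + 2 ℤ.* + (r ⊓ e)
  height-before-d zero _ = refl
  height-before-d (suc r) r<d with r % d <? e | height-before-d r (<⇒≤ r<d)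
  ... | yes r%d<e | eq =
    trans (cong (λ x → -1ℤ ℤ.+ x) (trans eq (cong (λ x → + r ℤ.- + 2 ℤ.* + x) (m≤n⇒m⊓n≡m (<⇒≤ r<e)))))
      (trans (down (+ r)) (cong (λ x → + suc r ℤ.- + 2 ℤ.* + x) (sym (m≤n⇒m⊓n≡m r<e))))
    where
    r<e : r < e
    r<e = subst (_< e) (m<n⇒m%n≡m r<d) r%d<e
    down : ∀ r → -1ℤ ℤ.+ (r ℤ.- + 2 ℤ.* r) ≡ (1ℤ ℤ.+ r) ℤ.- + 2 ℤ.* (1ℤ ℤ.+ r)
    down = solve-∀
  ... | no r%d≮e | eq =
    trans (cong (λ x → 1ℤ ℤ.+ x) (trans eq (cong (λ x → + r ℤ.- + 2 ℤ.* + x) (m≥n⇒m⊓n≡n e≤r))))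
      (trans (up (+ r) (+ e)) (cong (λ x → + suc r ℤ.- + 2 ℤ.* + x) (sym (m≥n⇒m⊓n≡n (m≤n⇒m≤1+n e≤r)))))
    where
    e≤r : e ≤ r
    e≤r = subst (e ≤_) (m<n⇒m%n≡m r<d) (≮⇒≥ r%d≮e)
    up : ∀ r e → 1ℤ ℤ.+ (r ℤ.- + 2 ℤ.* e) ≡ (1ℤ ℤ.+ r) ℤ.- + 2 ℤ.* e
    up = solve-∀

  height-d : height d ≡ b
  height-d = begin
    height d                        ≡⟨ height-before-d d ≤-refl ⟩
    + d ℤ.- + 2 ℤ.* + (d ⊓ e)       ≡⟨ cong₂ (λ x y → x ℤ.- + 2 ℤ.* + y) (sym b+2e≡d) (m≥n⇒m⊓n≡n e≤d) ⟩
    b ℤ.+ + (2 * e) ℤ.- + 2 ℤ.* + e ≡⟨ cong (λ x → b ℤ.+ x ℤ.- + 2 ℤ.* + e) (ℤ.pos-* 2 e) ⟩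
    b ℤ.+ + 2 ℤ.* + e ℤ.- + 2 ℤ.* + e ≡⟨ cancel b (+ e) ⟩
    b                               ∎
    where
    open ≡-Reasoning
    cancel : ∀ b e → b ℤ.+ + 2 ℤ.* e ℤ.- + 2 ℤ.* e ≡ b
    cancel = solve-∀

  height-+d : ∀ i → height (i + d) ≡ height i ℤ.+ b
  height-+d zero = trans height-d (sym (ℤ.+-identityˡ b))
  height-+d (suc i) = trans (cong₂ ℤ._+_ (rise-periodic i) (height-+d i)) (sym (ℤ.+-assoc (rise i) (height i) b))

  height-+*d : ∀ i t → height (i + t * d) ≡ height i ℤ.+ + t ℤ.* b
  height-+*d i zero = trans (cong height (+-identityʳ i)) (sym (ℤ.+-identityʳ (height i)))
  height-+*d i (suc t) = begin
    height (i + (d + t * d))               ≡⟨ cong height (regroup i d (t * d)) ⟩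
    height ((i + t * d) + d)               ≡⟨ height-+d (i + t * d) ⟩
    height (i + t * d) ℤ.+ b               ≡⟨ cong (ℤ._+ b) (height-+*d i t) ⟩
    height i ℤ.+ + t ℤ.* b ℤ.+ b           ≡⟨ collect (height i) (+ t) b ⟩
    height i ℤ.+ + suc t ℤ.* b             ∎
    where
    open ≡-Reasoning
    regroup : ∀ i d x → i + (d + x) ≡ (i + x) + d
    regroup = ℕ-solve-∀
    collect : ∀ h t b → h ℤ.+ t ℤ.* b ℤ.+ b ≡ h ℤ.+ (1ℤ ℤ.+ t) ℤ.* b
    collect = solve-∀

  module _ (bk≋d : b ℤ.* + k ≋ + d) (mk≋0 : + m ℤ.* + k ≋ 0ℤ) where

    -- A full turn of n = m d indices adds m b to the height, and m k ≡ 0. So height times k depends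
    -- only on the index modulo n.
    height-mod : ∀ i → height (i % n) ℤ.* + k ≋ height i ℤ.* + k
    height-mod i = ≋-linear₁ (ℤ.- (+ (i / n) ℤ.* b)) mk≋0 (begin
      height (i % n) ℤ.* + k ℤ.- height i ℤ.* + k
        ≡⟨ cong (λ x → height (i % n) ℤ.* + k ℤ.- x ℤ.* + k) unwind ⟩
      height (i % n) ℤ.* + k ℤ.- (height (i % n) ℤ.+ (+ (i / n) ℤ.* + m) ℤ.* b) ℤ.* + k
        ≡⟨ eq (height (i % n)) (+ k) (+ (i / n)) (+ m) b ⟩
      ℤ.- (+ (i / n) ℤ.* b) ℤ.* (+ m ℤ.* + k ℤ.- 0ℤ) ∎)
      where
      open ≡-Reasoning
      unwind : height i ≡ height (i % n) ℤ.+ (+ (i / n) ℤ.* + m) ℤ.* b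
      unwind = trans (cong height (trans (m≡m%n+[m/n]*n i n)
          (cong (λ x → i % n + x) (trans (cong (λ x → i / n * x) n≡md) (sym (*-assoc (i / n) m d))))))
        (trans (height-+*d (i % n) (i / n * m)) (cong (λ x → height (i % n) ℤ.+ x ℤ.* b) (ℤ.pos-* (i / n) m)))
      eq : ∀ h k t m b → h ℤ.* k ℤ.- (h ℤ.+ (t ℤ.* m) ℤ.* b) ℤ.* k ≡ ℤ.- (t ℤ.* b) ℤ.* (m ℤ.* k ℤ.- 0ℤ)
      eq = solve-∀

    -- As k = k′ d, the height grows by k′ b, and k′ b k ≡ k′ d = k.
    height-+k : ∀ i → height (i + k) ℤ.* + k ≋ height i ℤ.* + k ℤ.+ + k
    height-+k i = ≋-linear₁ (+ k′) bk≋d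
      (trans (cong₂ (λ x y → x ℤ.* + k ℤ.- (height i ℤ.* + k ℤ.+ y)) (trans (cong (λ x → height (i + x)) k≡k′d) (height-+*d i k′))
                (trans (cong +_ k≡k′d) (ℤ.pos-* k′ d)))
             (eq (height i) (+ k′) b (+ k) (+ d)))
      where
      eq : ∀ h k′ b k d → (h ℤ.+ k′ ℤ.* b) ℤ.* k ℤ.- (h ℤ.* k ℤ.+ k′ ℤ.* d) ≡ k′ ℤ.* (b ℤ.* k ℤ.- d)
      eq = solve-∀

    -- An outer edge changes the height by 1 or -1, hence the position by k or -k, which is an inner
    -- edge. The extra k on the inner side makes spokes edges as well.
    position : Side → ℕ → ℤ
    position outer i = height i ℤ.* + k
    position inner i = height i ℤ.* + k ℤ.+ + k

    retract : V → V
    retract (s , i) = inner , proj₁ (residue (position s (toℕ i)))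

    inner-edge : ∀ {u x y} → IsUnit u → y ≋ x ℤ.+ u ℤ.* + k →
      E (inner , proj₁ (residue x)) (inner , proj₁ (residue y))
    inner-edge {u} {x} {y} isUnit y≋ = unit-shift⇒edge inner isUnit (shifted
      (≋-trans (proj₂ (residue y)) (≋-trans y≋
        (≋-linear₁ -1ℤ (proj₂ (residue x)) (eq (+ toℕ (proj₁ (residue x))) x (u ℤ.* + k))))))
      where
      eq : ∀ r x c → (x ℤ.+ c) ℤ.- (r ℤ.+ c) ≡ -1ℤ ℤ.* (r ℤ.- x)
      eq = solve-∀

    retract-step : ∀ s {i j} → StepMod n (∣ step s ∣) i j → E (retract (s , i)) (retract (s , j))
    retract-step outer {i} {j} e = inner-edge (residue-rise-unit (toℕ i % d)) (subst (λ x → height x ℤ.* + k ≋ height (toℕ i) ℤ.* + k ℤ.+ rise (toℕ i) ℤ.* + k) e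
      (≋-trans (height-mod (toℕ i + 1)) (≋-reflexive (trans (cong (λ x → height x ℤ.* + k) (+-comm (toℕ i) 1)) (eq (rise (toℕ i)) (height (toℕ i)) (+ k))))))
      where
      eq : ∀ u h k → (u ℤ.+ h) ℤ.* k ≡ h ℤ.* k ℤ.+ u ℤ.* k
      eq = solve-∀
    retract-step inner {i} {j} e = inner-edge (inj₁ refl) (subst (λ x → height x ℤ.* + k ℤ.+ + k ≋ height (toℕ i) ℤ.* + k ℤ.+ + k ℤ.+ 1ℤ ℤ.* + k) e
      (≋-linear₁ 1ℤ (≋-trans (height-mod (toℕ i + k)) (height-+k (toℕ i))) (eq (height ((toℕ i + k) % n) ℤ.* + k) (height (toℕ i) ℤ.* + k) (+ k))))
      where
      eq : ∀ x y k → (x ℤ.+ k) ℤ.- (y ℤ.+ k ℤ.+ 1ℤ ℤ.* k) ≡ 1ℤ ℤ.* (x ℤ.- (y ℤ.+ k))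
      eq = solve-∀

    retract-spoke : ∀ i → E (retract (outer , i)) (retract (inner , i))
    retract-spoke i = inner-edge (inj₁ refl) (≋-reflexive (cong (λ x → height (toℕ i) ℤ.* + k ℤ.+ x) (sym (ℤ.*-identityˡ (+ k)))))

    retract-endo : IsEndo E retract
    retract-endo {outer , i} {outer , j} (inj₁ e) = retract-step outer {i} {j} e
    retract-endo {outer , i} {outer , j} (inj₂ e) = E-sym {retract (outer , j)} {retract (outer , i)} (retract-step outer {j} {i} e)
    retract-endo {inner , i} {inner , j} (inj₁ e) = retract-step inner {i} {j} e
    retract-endo {inner , i} {inner , j} (inj₂ e) = E-sym {retract (inner , j)} {retract (inner , i)} (retract-step inner {j} {i} e)
    retract-endo {outer , i} {inner , .i} refl = retract-spoke i
    retract-endo {inner , i} {outer , .i} refl = E-sym {retract (outer , i)} {retract (inner , i)} (retract-spoke i)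

    -- The image contains no outer vertex, so `retract` is not onto.
    ¬core : ¬ IsCore E
    ¬core core = misses (proj₂ (proj₁ (core retract (λ {x} {y} → retract-endo {x} {y}))) (outer , proj₁ (residue 0ℤ)))
      where
      inner≢outer : inner ≢ outer
      inner≢outer ()
      misses : ¬ (∃ λ x → ∀ {z} → z ≡ x → retract z ≡ (outer , proj₁ (residue 0ℤ)))
      misses (x , hit) = inner≢outer (cong proj₁ (hit refl))

-- The three conditions and the equivalences

module Cases (n k : ℕ) .{{_ : NonZero n}} (0<k : 0 < k) (2k<n : 2 * k < n)
    (m d k′ a : ℕ) {{_ : NonZero d}} (n≡md : n ≡ m * d) (k≡k′d : k ≡ k′ * d) (a<m : a < m)
    (nonbipartite : ¬ IsBipartite (GPAdj n k)) where
  open Characterization n k 0<k 2k<n m d k′ a n≡md k≡k′d a<m public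

  Cases : Set
  Cases = Even m ⊎ FirstCase ⊎ SecondCase

  module _ (ak≋d : + a ℤ.* + k ≋ + d) where

    even-k : Even m → Even k
    even-k even-m = decidable-stable (2 ∣? k) λ odd-k →
      nonbipartite (bipartite (subst (2 ∣_) (sym n≡md) (∣m⇒∣m*n d even-m)) odd-k)

    -- The net count is a multiple of the even m, so no odd closed walk avoids spokes.
    spokeless-even : Even m → ∀ {N} → SpokelessOddWalk≥ N
    spokeless-even even-m s p c p≋0 odd =
      contradiction (∣m∣n⇒∣m+n (∣-trans even-m (side-period ak≋d s p p≋0)) (m∣m*n c)) odd

    -- An odd length makes the net count nonzero, and it is a multiple of m.
    spokeless-odd : ∀ {N} → N ≤ m → SpokelessOddWalk≥ N
    spokeless-odd N≤m s p c p≋0 odd = ≤-trans N≤m (≤-trans (∣⇒≤ {{≢-nonZero ∣p∣≢0}} (side-period ak≋d s p p≋0)) (m≤m+n (∣ p ∣) (2 * c)))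
      where
      ∣p∣≢0 : ∣ p ∣ ≢ 0
      ∣p∣≢0 ∣p∣≡0 = odd (subst (λ x → 2 ∣ x + 2 * c) (sym ∣p∣≡0) (m∣m*n c))

    spokeless : ∀ {N} → N ≤ m → SpokelessOddWalk≥ N
    spokeless N≤m with 2 ∣? m
    ... | yes even-m = spokeless-even even-m
    ... | no _ = spokeless-odd N≤m

    cases⇒shortestTwoSpoke : Cases → ShortestTwoSpoke
    cases⇒shortestTwoSpoke (inj₁ even-m) =
      -- k outer steps are undone by one inner step; k is even since otherwise the graph would be
      -- bipartite.
      shortestTwoSpoke (odd-k+1 , + k , -1ℤ , ≋-reflexive (eq (+ k)) , refl) (spokeless-even even-m)
      where
      odd-k+1 : Odd (k + 1)
      odd-k+1 even = even-suc⇒odd (subst (2 ∣_) (+-comm k 1) even) (even-k even-m)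
      eq : ∀ k → k ℤ.* 1ℤ ℤ.+ -1ℤ ℤ.* k ≡ 0ℤ
      eq = solve-∀
    cases⇒shortestTwoSpoke (inj₂ (inj₁ (even-a+d , d+2≤a))) with 2 ∣? m
    ... | yes even-m = cases⇒shortestTwoSpoke (inj₁ even-m)
    ... | no odd-m =
      -- Modulo n, (m - a) k ≡ - d. Replacing - a by m - a changes the parity of the length, as m is
      -- odd.
      shortestTwoSpoke {d + (m ∸ a)} (odd-span , + d , + (m ∸ a) , balanced , refl) (spokeless-odd bound)
      where
      a+[m-a]≡m : a + (m ∸ a) ≡ m
      a+[m-a]≡m = m+[n∸m]≡n (<⇒≤ a<m)

      odd-span : Odd (d + (m ∸ a))
      odd-span even = odd-m (∣m+n∣m⇒∣n (subst (2 ∣_) (trans (eq a d (m ∸ a)) (cong (λ x → 2 * d + x) a+[m-a]≡m))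
        (∣m∣n⇒∣m+n even-a+d even)) (m∣m*n d))
        where
        eq : ∀ a d x → a + d + (d + x) ≡ 2 * d + (a + x)
        eq = ℕ-solve-∀

      balanced : Balanced outer (+ d) (+ (m ∸ a))
      balanced = ≋-linear₂ -1ℤ 1ℤ ak≋d (mk≋0 ak≋d) (trans (eq (+ a) (+ d) (+ k) (+ (m ∸ a)))
        (cong (λ x → -1ℤ ℤ.* (+ a ℤ.* + k ℤ.- + d) ℤ.+ 1ℤ ℤ.* (+ x ℤ.* + k ℤ.- 0ℤ)) a+[m-a]≡m))
        where
        eq : ∀ a d k x → (d ℤ.* 1ℤ ℤ.+ x ℤ.* k) ℤ.- 0ℤ
             ≡ -1ℤ ℤ.* (a ℤ.* k ℤ.- d) ℤ.+ 1ℤ ℤ.* ((a ℤ.+ x) ℤ.* k ℤ.- 0ℤ)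
        eq = solve-∀

      bound : 2 + (d + (m ∸ a)) ≤ m
      bound = subst₂ _≤_ (eq d (m ∸ a)) a+[m-a]≡m (+-monoˡ-≤ (m ∸ a) d+2≤a)
        where
        eq : ∀ d x → d + 2 + x ≡ 2 + (d + x)
        eq = ℕ-solve-∀
    cases⇒shortestTwoSpoke (inj₂ (inj₂ (odd-a+d , a+d+2≤m))) =
      shortestTwoSpoke {a + d} (odd-a+d , + d , ℤ.- + a , ≋-linear₁ -1ℤ ak≋d (eq (+ a) (+ d) (+ k)) ,
          trans (cong (λ x → d + x) (ℤ.∣-i∣≡∣i∣ (+ a))) (+-comm d a))
        (spokeless (subst (_≤ m) (+-comm (a + d) 2) a+d+2≤m))
      where
      eq : ∀ a d k → (d ℤ.* 1ℤ ℤ.+ ℤ.- a ℤ.* k) ℤ.- 0ℤ ≡ -1ℤ ℤ.* (a ℤ.* k ℤ.- d)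
      eq = solve-∀

    cases⊎flat : Cases ⊎ (Odd m × FlatCase)
    cases⊎flat with 2 ∣? m
    ... | yes even-m = inj₁ (inj₁ even-m)
    ... | no odd-m with trichotomy ak≋d odd-m
    ...   | inj₁ first = inj₁ (inj₂ (inj₁ first))
    ...   | inj₂ (inj₁ second) = inj₁ (inj₂ (inj₂ second))
    ...   | inj₂ (inj₂ flat) = inj₂ (odd-m , flat)

    shortestTwoSpoke⇒cases : ShortestTwoSpoke → Cases
    shortestTwoSpoke⇒cases short with cases⊎flat
    ... | inj₁ cases = cases
    ... | inj₂ (odd-m , flat) = contradiction short (flat⇒¬shortestTwoSpoke ak≋d odd-m flat)

    core⇒cases : IsCore E → Cases
    core⇒cases core with cases⊎flat
    ... | inj₁ cases = cases
    ... | inj₂ (_ , e , b , e≤d , b+2e≡d , bk≋d) =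
      contradiction core (Retraction.¬core n k m d k′ n≡md k≡k′d e b e≤d b+2e≡d bk≋d (mk≋0 ak≋d))

theorem2p1 : (n k : ℕ) .{{_ : NonZero n}} → 0 < k → 2 * k < n →
    ¬ IsBipartite (GPAdj n k) →
    (a : ℕ) → 0 < a → a < n/d n k → (a * k) % n ≡ gcd n k % n →
    (IsCore (GPAdj n k) ⇔ SomeMinOddCycleHasSpoke n k)
    × (SomeMinOddCycleHasSpoke n k ⇔
    (Even (n/d n k)
    ⊎ (Even (a + gcd n k) × gcd n k + 2 ≤ a)
    ⊎ (Odd (a + gcd n k) × a + gcd n k + 2 ≤ n/d n k)))
theorem2p1 n k 0<k 2k<n nonbipartite a _ a<m ak≡d =
  -- Every implication passes through `ShortestTwoSpoke`, the numerical form of (b); from (a) it is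
  -- reached by way of (c).
  mk⇔ (shortestTwoSpoke⇒hasSpoke ∘ cases⇒shortestTwoSpoke ak≋d ∘ core⇒cases ak≋d)
      (shortestTwoSpoke⇒core ∘ hasSpoke⇒shortestTwoSpoke) ,
  mk⇔ (shortestTwoSpoke⇒cases ak≋d ∘ hasSpoke⇒shortestTwoSpoke)
      (shortestTwoSpoke⇒hasSpoke ∘ cases⇒shortestTwoSpoke ak≋d)
  where
  d∣n = gcd[m,n]∣m n k
  d∣k = gcd[m,n]∣n n k

  instance
    d-nonZero : NonZero (gcd n k)
    d-nonZero = ≢-nonZero (gcd[m,n]≢0 n k (inj₂ (m<n⇒n≢0 0<k)))

  open Cases n k 0<k 2k<n (n/d n k) (gcd n k) (quotient d∣k) a (_∣_.equality d∣n) (_∣_.equality d∣k) a<m nonbipartite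

  ak≋d : + a ℤ.* + k ≋ + gcd n k
  ak≋d = ≋-trans (≋-reflexive (sym (ℤ.pos-* a k)))
    (≋-trans (≋-sym (%-≋ (a * k))) (≋-trans (≋-reflexive (cong +_ ak≡d)) (%-≋ (gcd n k))))
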